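{- Let $H=(V,E)$ be a partition-connected hypergraph with $|V|\ge2$, and let $\Gamma(H)$ be its hypertree family. Then $$\operatorname{Mod}_1(\Gamma(H))=S(H).$$
   Context: A hypergraph $H=(V,E)$ has a finite nonempty vertex set $V$ and a finite collection $E$ of subsets of $V$ (hyperedges), where repetitions are allowed (parallel hyperedges are distinct elements of $E$) and every hyperedge has at least two vertices. For a partition $\mathscr P$ of $V$ into nonempty parts, $|\mathscr P|$ is the number of parts and $\delta(\mathscr P)$ is the set of hyperedges intersecting at least two parts. $H$ is partition-connected if $|\delta(\mathscr P)|\ge|\mathscr P|-1$ for every partition $\mathscr P$ of $V$. The strength of $H$ is $S(H)=\min\left\{\frac{|\delta(\mathscr P)|}{|\mathscr P|-1}:\mathscr P\text{ a partition of }V,\ |\mathscr P|\ge2\right\}$. A set $F\subseteq E$ is a hyperforest if for every nonempty $X\subseteq V$ at most $|X|-1$ hyperedges of $F$ are contained in $X$; a hypertree is a hyperforest with $|F|=|V|-1$. The hypertree family $\Gamma(H)$ is the family of all hypertrees of $H$, each identified with its indicator vector in $\mathbb{R}^E_{\ge 0}$. For a family $\Gamma\subset\mathbb{R}^E_{\ge0}$, $\operatorname{Adm}(\Gamma)=\{\rho\in\mathbb{R}^E_{\ge0}:\gamma^T\rho\ge1\ \forall\gamma\in\Gamma\}$ and $\operatorname{Mod}_1(\Gamma)=\inf_{\rho\in\operatorname{Adm}(\Gamma)}\sum_{e\in E}\rho(e)$. -}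

module Defs where

open import Data.Bool using (if_then_else_)
open import Data.Fin using (Fin)
open import Data.Fin.Properties as Fin using (any?)
open import Data.Fin.Subset using (Subset; _∈_; _∩_; ∣_∣; Nonempty)
open import Data.Fin.Subset.Properties using (_∈?_; _⊆?_)
open import Data.Integer using (+_)
open import Data.Nat as ℕ using (ℕ; _∸_)
import Data.Nat.Properties as ℕ
open import Data.Product using (Σ; ∃-syntax; ∃₂; _×_; _,_)
open import Data.Rational as ℚ using (ℚ; 0ℚ; 1ℚ; ½)
import Data.Rational.Properties as ℚ
open import Data.Rational.Solver using (module +-*-Solver)
import Data.Vec as Vec
open import Data.Vec.Functional as Vector using (Vector)
open import Function.Definitions using (StrictlySurjective)
open import Relation.Binary.PropositionalEquality
open import Relation.Nullary.Decidable using (Dec; does; ¬?; _×-dec_)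
open import Relation.Nullary.Negation using (¬_)

-- Real numbers: Cauchy sequences of rationals with pointwise operations.  They
-- are not quotiented; equality of reals is `x ≤ᴿ y × y ≤ᴿ x`.

IsCauchy : (ℕ → ℚ) → Set
IsCauchy x = ∀ ε → 0ℚ ℚ.< ε →
  ∃[ N ] (∀ m n → N ℕ.≤ m → N ℕ.≤ n → ℚ.∣ x m ℚ.- x n ∣ ℚ.< ε)

record ℝ : Set where
  constructor mkℝ
  field
    seq    : ℕ → ℚ
    cauchy : IsCauchy seq

open ℝ public

infix 4 _≤ᴿ_
_≤ᴿ_ : ℝ → ℝ → Set
x ≤ᴿ y = ∀ ε → 0ℚ ℚ.< ε → ∃[ N ] (∀ n → N ℕ.≤ n → seq x n ℚ.≤ seq y n ℚ.+ ε)

fromℚ : ℚ → ℝ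
fromℚ q = mkℝ (λ _ → q) λ ε 0<ε → 0 , λ _ _ _ _ →
  subst (ℚ._< ε) (sym (cong ℚ.∣_∣ (ℚ.+-inverseʳ q))) 0<ε

0ℝ 1ℝ : ℝ
0ℝ = fromℚ 0ℚ
1ℝ = fromℚ 1ℚ

+-cauchy : ∀ x y → IsCauchy x → IsCauchy y → IsCauchy (λ n → x n ℚ.+ y n)
+-cauchy x y cx cy ε 0<ε with cx (½ ℚ.* ε) 0<½ε | cy (½ ℚ.* ε) 0<½ε
  where
  0<½ε : 0ℚ ℚ.< ½ ℚ.* ε
  0<½ε = subst (ℚ._< ½ ℚ.* ε) (ℚ.*-zeroʳ ½) (ℚ.*-monoʳ-<-pos ½ 0<ε)
... | M , hx | N , hy = M ℕ.⊔ N , λ m n m≥ n≥ → begin-strict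
    ℚ.∣ (x m ℚ.+ y m) ℚ.- (x n ℚ.+ y n) ∣
      ≡⟨ cong ℚ.∣_∣ (regroup (x m) (y m) (x n) (y n)) ⟩
    ℚ.∣ (x m ℚ.- x n) ℚ.+ (y m ℚ.- y n) ∣
      ≤⟨ ℚ.∣p+q∣≤∣p∣+∣q∣ (x m ℚ.- x n) (y m ℚ.- y n) ⟩
    ℚ.∣ x m ℚ.- x n ∣ ℚ.+ ℚ.∣ y m ℚ.- y n ∣
      <⟨ ℚ.+-mono-< (hx m n (ℕ.m⊔n≤o⇒m≤o M N m≥) (ℕ.m⊔n≤o⇒m≤o M N n≥))
                    (hy m n (ℕ.m⊔n≤o⇒n≤o M N m≥) (ℕ.m⊔n≤o⇒n≤o M N n≥)) ⟩
    ½ ℚ.* ε ℚ.+ ½ ℚ.* ε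
      ≡⟨ ℚ.*-distribʳ-+ ε ½ ½ ⟨
    1ℚ ℚ.* ε
      ≡⟨ ℚ.*-identityˡ ε ⟩
    ε ∎
  where
  open ℚ.≤-Reasoning
  regroup : ∀ a b c d → (a ℚ.+ b) ℚ.- (c ℚ.+ d) ≡ (a ℚ.- c) ℚ.+ (b ℚ.- d)
  regroup = solve 4 (λ a b c d → (a :+ b) :- (c :+ d) := (a :- c) :+ (b :- d)) refl
    where open +-*-Solver

eventuallyBounded : ∀ x → IsCauchy x →
  ∃₂ λ B N → 0ℚ ℚ.< B × (∀ n → N ℕ.≤ n → ℚ.∣ x n ∣ ℚ.≤ B)
eventuallyBounded x cx with cx 1ℚ (ℚ.positive⁻¹ 1ℚ)
... | N , h = 1ℚ ℚ.+ ℚ.∣ x N ∣ , N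
  , ℚ.+-mono-<-≤ (ℚ.positive⁻¹ 1ℚ) (ℚ.0≤∣p∣ (x N))
  , λ n n≥ → begin
    ℚ.∣ x n ∣                              ≡⟨ cong ℚ.∣_∣ (split (x n) (x N)) ⟩
    ℚ.∣ (x n ℚ.- x N) ℚ.+ x N ∣            ≤⟨ ℚ.∣p+q∣≤∣p∣+∣q∣ (x n ℚ.- x N) (x N) ⟩
    ℚ.∣ x n ℚ.- x N ∣ ℚ.+ ℚ.∣ x N ∣        ≤⟨ ℚ.+-monoˡ-≤ ℚ.∣ x N ∣
                                                (ℚ.<⇒≤ (h n N n≥ ℕ.≤-refl)) ⟩
    1ℚ ℚ.+ ℚ.∣ x N ∣ ∎
  where
  open ℚ.≤-Reasoning
  split : ∀ a b → a ≡ (a ℚ.- b) ℚ.+ b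
  split = solve 2 (λ a b → a := (a :- b) :+ b) refl
    where open +-*-Solver

∣p*q∣<B*δ : ∀ {B δ} p q → 0ℚ ℚ.< B → ℚ.∣ p ∣ ℚ.≤ B → ℚ.∣ q ∣ ℚ.< δ →
           ℚ.∣ p ℚ.* q ∣ ℚ.< B ℚ.* δ
∣p*q∣<B*δ {B} {δ} p q 0<B p≤ q< = begin-strict
  ℚ.∣ p ℚ.* q ∣          ≡⟨ ℚ.∣p*q∣≡∣p∣*∣q∣ p q ⟩
  ℚ.∣ p ∣ ℚ.* ℚ.∣ q ∣    ≤⟨ ℚ.*-monoʳ-≤-nonNeg ℚ.∣ q ∣ {{ℚ.nonNegative (ℚ.0≤∣p∣ q)}} p≤ ⟩
  B ℚ.* ℚ.∣ q ∣          <⟨ ℚ.*-monoʳ-<-pos B {{ℚ.positive 0<B}} q< ⟩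
  B ℚ.* δ ∎
  where open ℚ.≤-Reasoning

divide : ∀ C ε → 0ℚ ℚ.< C → 0ℚ ℚ.< ε → ∃[ δ ] (0ℚ ℚ.< δ × C ℚ.* δ ≡ ε)
divide C ε 0<C 0<ε = C⁻¹ ℚ.* ε
  , subst (ℚ._< C⁻¹ ℚ.* ε) (ℚ.*-zeroʳ C⁻¹) (ℚ.*-monoʳ-<-pos C⁻¹ {{C⁻¹⁺}} 0<ε)
  , trans (sym (ℚ.*-assoc C C⁻¹ ε))
      (trans (cong (ℚ._* ε) (ℚ.*-inverseʳ C)) (ℚ.*-identityˡ ε))
  where
  instance
    C⁺ : ℚ.Positive C
    C⁺ = ℚ.positive 0<C
    C≢0 : ℚ.NonZero C
    C≢0 = ℚ.pos⇒nonZero C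
  C⁻¹ : ℚ
  C⁻¹ = ℚ.1/ C
  C⁻¹⁺ : ℚ.Positive C⁻¹
  C⁻¹⁺ = ℚ.1/pos⇒pos C

*-cauchy : ∀ x y → IsCauchy x → IsCauchy y → IsCauchy (λ n → x n ℚ.* y n)
*-cauchy x y cx cy ε 0<ε =
  let A , K , 0<A , x≤A = eventuallyBounded x cx
      B , L , 0<B , y≤B = eventuallyBounded y cy
      δ , 0<δ , eq = divide (A ℚ.+ B) ε (ℚ.+-mono-< 0<A 0<B) 0<ε
      M , hx = cx δ 0<δ
      N , hy = cy δ 0<δ
  in (K ℕ.⊔ L) ℕ.⊔ (M ℕ.⊔ N) , λ m n m≥ n≥ →
    let m≥KL = ℕ.m⊔n≤o⇒m≤o (K ℕ.⊔ L) (M ℕ.⊔ N) m≥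
        m≥MN = ℕ.m⊔n≤o⇒n≤o (K ℕ.⊔ L) (M ℕ.⊔ N) m≥
        n≥KL = ℕ.m⊔n≤o⇒m≤o (K ℕ.⊔ L) (M ℕ.⊔ N) n≥
        n≥MN = ℕ.m⊔n≤o⇒n≤o (K ℕ.⊔ L) (M ℕ.⊔ N) n≥
    in subst (ℚ.∣ x m ℚ.* y m ℚ.- x n ℚ.* y n ∣ ℚ.<_) eq
         (close (x m) (y m) (x n) (y n) A B δ 0<A 0<B
           (x≤A m (ℕ.m⊔n≤o⇒m≤o K L m≥KL))
           (y≤B n (ℕ.m⊔n≤o⇒n≤o K L n≥KL))
           (hx m n (ℕ.m⊔n≤o⇒m≤o M N m≥MN) (ℕ.m⊔n≤o⇒m≤o M N n≥MN))
           (hy m n (ℕ.m⊔n≤o⇒n≤o M N m≥MN) (ℕ.m⊔n≤o⇒n≤o M N n≥MN)))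
  where
  regroup : ∀ a b c d → a ℚ.* b ℚ.- c ℚ.* d ≡ a ℚ.* (b ℚ.- d) ℚ.+ d ℚ.* (a ℚ.- c)
  regroup = solve 4 (λ a b c d → a :* b :- c :* d := a :* (b :- d) :+ d :* (a :- c)) refl
    where open +-*-Solver

  close : ∀ a b c d A B δ → 0ℚ ℚ.< A → 0ℚ ℚ.< B → ℚ.∣ a ∣ ℚ.≤ A → ℚ.∣ d ∣ ℚ.≤ B →
          ℚ.∣ a ℚ.- c ∣ ℚ.< δ → ℚ.∣ b ℚ.- d ∣ ℚ.< δ →
          ℚ.∣ a ℚ.* b ℚ.- c ℚ.* d ∣ ℚ.< (A ℚ.+ B) ℚ.* δ
  close a b c d A B δ 0<A 0<B a≤ d≤ ac< bd< = begin-strict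
    ℚ.∣ a ℚ.* b ℚ.- c ℚ.* d ∣
      ≡⟨ cong ℚ.∣_∣ (regroup a b c d) ⟩
    ℚ.∣ a ℚ.* (b ℚ.- d) ℚ.+ d ℚ.* (a ℚ.- c) ∣
      ≤⟨ ℚ.∣p+q∣≤∣p∣+∣q∣ (a ℚ.* (b ℚ.- d)) (d ℚ.* (a ℚ.- c)) ⟩
    ℚ.∣ a ℚ.* (b ℚ.- d) ∣ ℚ.+ ℚ.∣ d ℚ.* (a ℚ.- c) ∣
      <⟨ ℚ.+-mono-< (∣p*q∣<B*δ a (b ℚ.- d) 0<A a≤ bd<) (∣p*q∣<B*δ d (a ℚ.- c) 0<B d≤ ac<) ⟩
    A ℚ.* δ ℚ.+ B ℚ.* δ
      ≡⟨ ℚ.*-distribʳ-+ δ A B ⟨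
    (A ℚ.+ B) ℚ.* δ ∎
    where open ℚ.≤-Reasoning

infixl 6 _+ᴿ_
_+ᴿ_ : ℝ → ℝ → ℝ
x +ᴿ y = mkℝ (λ n → seq x n ℚ.+ seq y n) (+-cauchy (seq x) (seq y) (cauchy x) (cauchy y))

infixl 7 _*ᴿ_
_*ᴿ_ : ℝ → ℝ → ℝ
x *ᴿ y = mkℝ (λ n → seq x n ℚ.* seq y n) (*-cauchy (seq x) (seq y) (cauchy x) (cauchy y))

sum : ∀ {n} → Vector ℝ n → ℝ
sum = Vector.foldr _+ᴿ_ 0ℝ

infix 8 _ᵀ_
_ᵀ_ : ∀ {n} → Vector ℝ n → Vector ℝ n → ℝ
γ ᵀ ρ = sum (Vector.zipWith _*ᴿ_ γ ρ)

IsMinimum : (ℚ → Set) → ℚ → Set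
IsMinimum A s = A s × (∀ q → A q → s ℚ.≤ q)

-- r is the infimum of { f a : P a }.
IsInfimum : {A : Set} → (A → Set) → (A → ℝ) → ℝ → Set
IsInfimum P f r =
  (∀ a → P a → r ≤ᴿ f a) ×
  (∀ l → (∀ a → P a → l ≤ᴿ f a) → l ≤ᴿ r)

module _ {m : ℕ} {I : Set} (Γ : I → Vector ℝ m) where

  Adm : Vector ℝ m → Set
  Adm ρ = (∀ e → 0ℝ ≤ᴿ ρ e) × (∀ i → 1ℝ ≤ᴿ Γ i ᵀ ρ)

  IsMod₁ : ℝ → Set
  IsMod₁ = IsInfimum Adm sum

-- Hyperedges are indexed by Fin nE, so parallel hyperedges are distinct.
record Hypergraph : Set where
  field
    nV nE    : ℕ
    nonempty : 1 ℕ.≤ nV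
    edge     : Fin nE → Subset nV
    edge-≥2  : ∀ e → 2 ℕ.≤ ∣ edge e ∣

-- A partition of Fin n; the parts are the fibres of `part`, and they are
-- nonempty by surjectivity.
record Partition (n : ℕ) : Set where
  field
    size       : ℕ
    part       : Fin n → Fin size
    surjective : StrictlySurjective _≡_ part

module _ (H : Hypergraph) where
  open Hypergraph H

  module _ (P : Partition nV) where
    open Partition P

    Meets : Fin nE → Fin size → Set
    Meets e i = ∃[ v ] (v ∈ edge e × part v ≡ i)

    meets? : ∀ e i → Dec (Meets e i)
    meets? e i = any? λ v → (v ∈? edge e) ×-dec (part v Fin.≟ i)

    Crosses : Fin nE → Set
    Crosses e = ∃₂ λ i j → ¬ i ≡ j × Meets e i × Meets e j

    crosses? : ∀ e → Dec (Crosses e)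
    crosses? e = any? λ i → any? λ j →
      ¬? (i Fin.≟ j) ×-dec (meets? e i ×-dec meets? e j)

    δ : Subset nE
    δ = Vec.tabulate λ e → does (crosses? e)

    ratio : 2 ℕ.≤ size → ℚ
    ratio 2≤k = (+ ∣ δ ∣ ℚ./ (size ∸ 1)) {{ℕ.>-nonZero (ℕ.m<n⇒0<n∸m 2≤k)}}

  PartitionConnected : Set
  PartitionConnected = ∀ P → Partition.size P ∸ 1 ℕ.≤ ∣ δ P ∣

  IsStrength : ℚ → Set
  IsStrength = IsMinimum λ q → ∃₂ λ P 2≤k → q ≡ ratio P 2≤k

  edgesWithin : Subset nV → Subset nE
  edgesWithin X = Vec.tabulate λ e → does (edge e ⊆? X)

  IsHyperforest : Subset nE → Set
  IsHyperforest F = ∀ X → Nonempty X → ∣ F ∩ edgesWithin X ∣ ℕ.≤ ∣ X ∣ ∸ 1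

  IsHypertree : Subset nE → Set
  IsHypertree F = IsHyperforest F × ∣ F ∣ ≡ nV ∸ 1

  Hypertree : Set
  Hypertree = Σ (Subset nE) IsHypertree

  hypertreeFamily : Hypertree → Vector ℝ nE
  hypertreeFamily (F , _) e = if does (e ∈? F) then 1ℝ else 0ℝ

{-# OPTIONS --safe #-}
module Submission where

-- Upper bound: if 𝒫 attains the strength s, then 1_{δ(𝒫)} / (|𝒫| − 1) is admissible, since a
-- hypertree has at most |X| − 1 hyperedges inside each part X and hence at least |𝒫| − 1 in δ(𝒫).
--
-- Lower bound: for rational ρ ≥ 0 the greedy hypertree T, built by scanning the hyperedges in
-- order of increasing ρ, satisfies s ρ(T) ≤ ρ(E).  By Abel summation it suffices that at each
-- stage s (|V| − 1 − |F|) ≤ |R|, where F is the hyperforest built so far and R the set of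
-- hyperedges not yet scanned.  The sets X containing exactly |X| − 1 hyperedges of F are closed
-- under intersecting unions, so the maximal ones form a partition 𝒫 of V, and a scanned hyperedge
-- outside F lies inside a part.  Counting gives |V| − 1 − |F| = |𝒫| − 1 − |F ∩ δ(𝒫)|, while
-- s (|𝒫| − 1) ≤ |δ(𝒫)| ≤ |F ∩ δ(𝒫)| + |R|, and s ≥ 1 by partition-connectedness.

open import Defs
import Algebra.Properties.CommutativeMonoid.Sum
open import Data.Bool using (if_then_else_; true; false)
open import Data.Fin using (Fin; zero; suc)
import Data.Fin.Properties as Fin
open import Data.Fin.Subset hiding (_-_)
open import Data.Fin.Subset.Properties
import Data.Integer as ℤ
import Data.Integer.Properties as ℤ
import Data.Integer.Solver as ℤ
open import Data.List as List using (List; []; _∷_; length; map; concatMap; allFin)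
import Data.List.Properties as List
open import Data.List.Membership.Propositional using (lose) renaming (_∈_ to _∈ₗ_)
open import Data.List.Membership.Propositional.Properties using (∈-concatMap⁺; ∈-map⁺; ∈-tabulate⁺)
open import Data.List.Relation.Binary.Permutation.Propositional using (_↭_; ↭-sym; ↭⇒↭ₛ)
open import Data.List.Relation.Binary.Permutation.Propositional.Properties using (∈-resp-↭; map⁺)
import Data.List.Relation.Binary.Permutation.Setoid.Properties as Permutationₛ
open import Data.List.Relation.Unary.All as All using (All; []; _∷_)
open import Data.List.Relation.Unary.AllPairs using (AllPairs; []; _∷_)
open import Data.List.Relation.Unary.Any using (here; there)
open import Data.List.Relation.Unary.Sorted.TotalOrder.Properties using (Sorted⇒AllPairs)
import Data.List.Sort as Sort
open import Data.Nat as ℕ using (ℕ; _∸_; _+_; _≤_; _<_; s≤s; z≤n)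
import Data.Nat.Properties as ℕ
import Data.Nat.Solver as ℕ
open import Data.Product using (∃-syntax; ∃₂; _×_; _,_; proj₁; proj₂)
open import Data.Rational as ℚ using (ℚ; 0ℚ; 1ℚ)
import Data.Rational.Properties as ℚ
import Data.Rational.Solver as ℚ
open import Data.Rational.Unnormalised as ℚᵘ using (mkℚᵘ; *≡*; *≤*)
import Data.Rational.Unnormalised.Properties as ℚᵘ
open import Data.Sum as Sum using (_⊎_; inj₁; inj₂)
open import Data.Vec as Vec using ([]; _∷_; here; there)
import Data.Vec.Properties as Vec
open import Data.Vec.Functional using (Vector; zipWith)
open import Function using (_⇔_; mk⇔; _∘_; Equivalence)
open import Function.Properties.Equivalence using () renaming (trans to ⇔-trans)
open import Level using (0ℓ)
open import Relation.Binary using (Rel; IsDecEquivalence; DecTotalOrder)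
import Relation.Binary.Construct.On as On
open import Relation.Binary.PropositionalEquality
open import Relation.Nullary using (Dec; yes; no; ¬_; contradiction; does; _×-dec_; ¬?)
open import Relation.Nullary.Decidable using (map′; decidable-stable)
import Relation.Unary as U

open Equivalence using (to; from)
open Partition

module ℕΣ = Algebra.Properties.CommutativeMonoid.Sum ℕ.+-0-commutativeMonoid

-- Cardinalities of finite subsets

∈-tabulate-does⁺ : ∀ {n} {P : Fin n → Set} (P? : ∀ x → Dec (P x)) {x} →
                   P x → x ∈ Vec.tabulate (does ∘ P?)
∈-tabulate-does⁺ P? {x} px with P? x in eq
... | yes _ = Vec.lookup⇒[]= x _ (trans (Vec.lookup∘tabulate _ x) (cong does eq))
... | no ¬px = contradiction px ¬px

∈-tabulate-does⁻ : ∀ {n} {P : Fin n → Set} (P? : ∀ x → Dec (P x)) {x} →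
                   x ∈ Vec.tabulate (does ∘ P?) → P x
∈-tabulate-does⁻ P? {x} x∈ with P? x in eq
... | yes px = px
... | no _ with trans (sym (Vec.[]=⇒lookup x∈)) (trans (Vec.lookup∘tabulate _ x) (cong does eq))
...   | ()

∣p∪q∣+∣p∩q∣≡∣p∣+∣q∣ : ∀ {n} (p q : Subset n) → ∣ p ∪ q ∣ + ∣ p ∩ q ∣ ≡ ∣ p ∣ + ∣ q ∣
∣p∪q∣+∣p∩q∣≡∣p∣+∣q∣ [] [] = refl
∣p∪q∣+∣p∩q∣≡∣p∣+∣q∣ (outside ∷ p) (outside ∷ q) = ∣p∪q∣+∣p∩q∣≡∣p∣+∣q∣ p q
∣p∪q∣+∣p∩q∣≡∣p∣+∣q∣ (inside ∷ p) (outside ∷ q) = cong ℕ.suc (∣p∪q∣+∣p∩q∣≡∣p∣+∣q∣ p q)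
∣p∪q∣+∣p∩q∣≡∣p∣+∣q∣ (outside ∷ p) (inside ∷ q) =
  trans (cong ℕ.suc (∣p∪q∣+∣p∩q∣≡∣p∣+∣q∣ p q)) (sym (ℕ.+-suc ∣ p ∣ ∣ q ∣))
∣p∪q∣+∣p∩q∣≡∣p∣+∣q∣ (inside ∷ p) (inside ∷ q) = cong ℕ.suc (begin
  ∣ p ∪ q ∣ + ℕ.suc ∣ p ∩ q ∣  ≡⟨ ℕ.+-suc ∣ p ∪ q ∣ ∣ p ∩ q ∣ ⟩
  ℕ.suc (∣ p ∪ q ∣ + ∣ p ∩ q ∣)  ≡⟨ cong ℕ.suc (∣p∪q∣+∣p∩q∣≡∣p∣+∣q∣ p q) ⟩
  ℕ.suc (∣ p ∣ + ∣ q ∣)  ≡⟨ ℕ.+-suc ∣ p ∣ ∣ q ∣ ⟨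
  ∣ p ∣ + ℕ.suc ∣ q ∣  ∎)
  where open ≡-Reasoning

∣p∪q∣≤∣p∣+∣q∣ : ∀ {n} (p q : Subset n) → ∣ p ∪ q ∣ ≤ ∣ p ∣ + ∣ q ∣
∣p∪q∣≤∣p∣+∣q∣ p q = subst (∣ p ∪ q ∣ ≤_) (∣p∪q∣+∣p∩q∣≡∣p∣+∣q∣ p q) (ℕ.m≤m+n ∣ p ∪ q ∣ ∣ p ∩ q ∣)

∣p∪⁅x⁆∣≤suc∣p∣ : ∀ {n} (p : Subset n) x → ∣ p ∪ ⁅ x ⁆ ∣ ≤ ℕ.suc ∣ p ∣
∣p∪⁅x⁆∣≤suc∣p∣ p x = begin
  ∣ p ∪ ⁅ x ⁆ ∣      ≤⟨ ∣p∪q∣≤∣p∣+∣q∣ p ⁅ x ⁆ ⟩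
  ∣ p ∣ + ∣ ⁅ x ⁆ ∣  ≡⟨ cong (∣ p ∣ +_) (∣⁅x⁆∣≡1 x) ⟩
  ∣ p ∣ + 1          ≡⟨ ℕ.+-comm ∣ p ∣ 1 ⟩
  ℕ.suc ∣ p ∣        ∎
  where open ℕ.≤-Reasoning

∣p∣≡∣p∩q∣+∣p─q∣ : ∀ {n} (p q : Subset n) → ∣ p ∣ ≡ ∣ p ∩ q ∣ + ∣ p ─ q ∣
∣p∣≡∣p∩q∣+∣p─q∣ [] [] = refl
∣p∣≡∣p∩q∣+∣p─q∣ (outside ∷ p) (outside ∷ q) = ∣p∣≡∣p∩q∣+∣p─q∣ p q
∣p∣≡∣p∩q∣+∣p─q∣ (outside ∷ p) (inside ∷ q) = ∣p∣≡∣p∩q∣+∣p─q∣ p q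
∣p∣≡∣p∩q∣+∣p─q∣ (inside ∷ p) (inside ∷ q) = cong ℕ.suc (∣p∣≡∣p∩q∣+∣p─q∣ p q)
∣p∣≡∣p∩q∣+∣p─q∣ (inside ∷ p) (outside ∷ q) =
  trans (cong ℕ.suc (∣p∣≡∣p∩q∣+∣p─q∣ p q)) (sym (ℕ.+-suc ∣ p ∩ q ∣ ∣ p ─ q ∣))

x∈p─q⇒x∉q : ∀ {n} (p q : Subset n) {x} → x ∈ p ─ q → x ∉ q
x∈p─q⇒x∉q (_ ∷ p) (outside ∷ q) here ()
x∈p─q⇒x∉q (_ ∷ p) (_ ∷ q) (there x∈p─q) (there x∈q) = x∈p─q⇒x∉q p q x∈p─q x∈q

-- Induction on the number of pieces: `q zero` is split off, and by disjointness the other pieces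
-- partition `p ─ q zero`.
∣p∣≡∑∣q∣ : ∀ {n k} (p : Subset n) (q : Fin k → Subset n) →
           (∀ {x} → x ∈ p → ∃[ i ] x ∈ q i) →
           (∀ i → q i ⊆ p) →
           (∀ {x i j} → x ∈ q i → x ∈ q j → i ≡ j) →
           ∣ p ∣ ≡ ℕΣ.sum (∣_∣ ∘ q)
∣p∣≡∑∣q∣ {n} {ℕ.zero} p q cover q⊆p disj = trans (cong ∣_∣ p≡⊥) (∣⊥∣≡0 n)
  where
  p≡⊥ : p ≡ ⊥
  p≡⊥ = Empty-unique λ (x , x∈p) → Fin.¬Fin0 (proj₁ (cover x∈p))
∣p∣≡∑∣q∣ {k = ℕ.suc k} p q cover q⊆p disj = trans (∣p∣≡∣p∩q∣+∣p─q∣ p q₀)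
  (cong₂ _+_ (cong ∣_∣ p∩q₀≡q₀) (∣p∣≡∑∣q∣ (p ─ q₀) (q ∘ suc) cover′ q⊆p′ disj′))
  where
  q₀ = q zero
  p∩q₀≡q₀ : p ∩ q₀ ≡ q₀
  p∩q₀≡q₀ = ⊆-antisym (p∩q⊆q p q₀) λ x∈ → x∈p∩q⁺ (q⊆p zero x∈ , x∈)
  cover′ : ∀ {x} → x ∈ p ─ q₀ → ∃[ i ] x ∈ q (suc i)
  cover′ x∈ with cover (p─q⊆p p q₀ x∈)
  ... | zero , x∈q₀ = contradiction x∈q₀ (x∈p─q⇒x∉q p q₀ x∈)
  ... | suc i , x∈qᵢ = i , x∈qᵢ
  q⊆p′ : ∀ i → q (suc i) ⊆ p ─ q₀
  q⊆p′ i x∈ = x∈p∧x∉q⇒x∈p─q (q⊆p (suc i) x∈) λ x∈q₀ → Fin.0≢1+n (disj x∈q₀ x∈)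
  disj′ : ∀ {x i j} → x ∈ q (suc i) → x ∈ q (suc j) → i ≡ j
  disj′ x∈ x∈′ = Fin.suc-injective (disj x∈ x∈′)

-- The list entries are absorbed into `q` one at a time, each raising its cardinality by at most
-- one, so repetitions in the list do no harm.
∣p∣≤∣q∣+length : ∀ {n} (p q : Subset n) xs → (∀ {x} → x ∈ p → x ∈ q ⊎ x ∈ₗ xs) →
                 ∣ p ∣ ≤ ∣ q ∣ + length xs
∣p∣≤∣q∣+length p q [] cover =
  subst (∣ p ∣ ≤_) (sym (ℕ.+-identityʳ ∣ q ∣)) (p⊆q⇒∣p∣≤∣q∣ p⊆q)
  where
  p⊆q : p ⊆ q
  p⊆q x∈p with cover x∈p
  ... | inj₁ x∈q = x∈q
∣p∣≤∣q∣+length p q (y ∷ xs) cover = begin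
  ∣ p ∣                          ≤⟨ ∣p∣≤∣q∣+length p (q ∪ ⁅ y ⁆) xs cover′ ⟩
  ∣ q ∪ ⁅ y ⁆ ∣ + length xs      ≤⟨ ℕ.+-monoˡ-≤ (length xs) (∣p∪⁅x⁆∣≤suc∣p∣ q y) ⟩
  ℕ.suc (∣ q ∣ + length xs)      ≡⟨ ℕ.+-suc ∣ q ∣ (length xs) ⟨
  ∣ q ∣ + ℕ.suc (length xs)      ∎
  where
  open ℕ.≤-Reasoning
  cover′ : ∀ {x} → x ∈ p → x ∈ q ∪ ⁅ y ⁆ ⊎ x ∈ₗ xs
  cover′ x∈p with cover x∈p
  ... | inj₁ x∈q = inj₁ (p⊆p∪q ⁅ y ⁆ x∈q)
  ... | inj₂ (here refl) = inj₁ (q⊆p∪q q ⁅ y ⁆ (x∈⁅x⁆ y))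
  ... | inj₂ (there x∈xs) = inj₂ x∈xs

-- The value `f a pa` takes a proof of `P a`, as `ratio` takes a proof that there are two parts;
-- irrelevance makes the value depend on `a` alone.
argmin : ∀ {A : Set} {P : A → Set} → U.Decidable P → U.Irrelevant P →
         (f : ∀ a → P a → ℚ) (xs : List A) →
         All (¬_ ∘ P) xs ⊎ (∃₂ λ a pa → ∀ {b} → b ∈ₗ xs → ∀ pb → f a pa ℚ.≤ f b pb)
argmin P? irr f [] = inj₁ []
argmin P? irr f (x ∷ xs) with P? x | argmin P? irr f xs
... | no ¬px | inj₁ ¬pxs = inj₁ (¬px ∷ ¬pxs)
... | no ¬px | inj₂ (a , pa , min) = inj₂ (a , pa , λ
      { (here refl) pb → contradiction pb ¬px
      ; (there b∈) pb → min b∈ pb })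
... | yes px | inj₁ ¬pxs = inj₂ (x , px , λ
      { (here refl) pb → ℚ.≤-reflexive (cong (f x) (irr px pb))
      ; (there b∈) pb → contradiction pb (All.lookup ¬pxs b∈) })
... | yes px | inj₂ (a , pa , min) with ℚ.≤-total (f x px) (f a pa)
...   | inj₁ fx≤fa = inj₂ (x , px , λ
        { (here refl) pb → ℚ.≤-reflexive (cong (f x) (irr px pb))
        ; (there b∈) pb → ℚ.≤-trans fx≤fa (min b∈ pb) })
...   | inj₂ fa≤fx = inj₂ (a , pa , λ
        { (here refl) pb → subst (f a pa ℚ.≤_) (cong (f x) (irr px pb)) fa≤fx
        ; (there b∈) pb → min b∈ pb })

-- Partitions and the strength

-- The equivalence relation of a partition, which forgets how its parts are numbered.
Kernel : ∀ {n} → Partition n → Rel (Fin n) 0ℓ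
Kernel P v w = part P v ≡ part P w

emptyPartition : Partition 0
emptyPartition = record { size = 0 ; part = λ () ; surjective = λ () }

insertAlone : ∀ {n} → Partition n → Partition (ℕ.suc n)
insertAlone P = record
  { size = ℕ.suc (size P)
  ; part = λ { zero → zero ; (suc v) → suc (part P v) }
  ; surjective = λ { zero → zero , refl
                   ; (suc i) → let v , eq = surjective P i in suc v , cong suc eq }
  }

insertInto : ∀ {n} (P : Partition n) → Fin (size P) → Partition (ℕ.suc n)
insertInto P i = record
  { size = size P
  ; part = λ { zero → i ; (suc v) → part P v }
  ; surjective = λ j → let v , eq = surjective P j in suc v , eq
  }

extensions : ∀ {n} → Partition n → List (Partition (ℕ.suc n))
extensions P = insertAlone P ∷ map (insertInto P) (allFin (size P))

partitions : ∀ n → List (Partition n)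
partitions ℕ.zero = emptyPartition ∷ []
partitions (ℕ.suc n) = concatMap extensions (partitions n)

-- Used both to reduce the strength to a finite search and to turn a decidable equivalence into a
-- partition. By induction, the relation is restricted to the successors; vertex `zero` then joins
-- the part of an equivalent `u`, or stays alone if there is none.
partitions-complete : ∀ {n} {_≈_ : Rel (Fin n) 0ℓ} → IsDecEquivalence _≈_ →
                      ∃[ P ] (P ∈ₗ partitions n × (∀ v w → Kernel P v w ⇔ v ≈ w))
partitions-complete {ℕ.zero} _ = emptyPartition , here refl , λ ()
partitions-complete {ℕ.suc n} {_≈_} ≈-dec
  with partitions-complete (On.isDecEquivalence suc ≈-dec)
     | Fin.any? (λ w → IsDecEquivalence._≟_ ≈-dec zero (suc w))
... | P , P∈ , kerP | yes (u , 0≈u) =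
      insertInto P (part P u) ,
      ∈-concatMap⁺ extensions (lose P∈ (there (∈-map⁺ (insertInto P) (∈-tabulate⁺ (part P u))))) ,
      λ { zero zero → mk⇔ (λ _ → ≈.refl) (λ _ → refl)
        ; zero (suc w) → mk⇔ (λ eq → ≈.trans 0≈u (to (kerP u w) eq))
                             (λ 0≈w → from (kerP u w) (≈.trans (≈.sym 0≈u) 0≈w))
        ; (suc v) zero → mk⇔ (λ eq → ≈.trans (to (kerP v u) eq) (≈.sym 0≈u))
                             (λ v≈0 → from (kerP v u) (≈.trans v≈0 0≈u))
        ; (suc v) (suc w) → kerP v w }
  where module ≈ = IsDecEquivalence ≈-dec
... | P , P∈ , kerP | no ¬∃ =
      insertAlone P ,
      ∈-concatMap⁺ extensions (lose P∈ (here refl)) ,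
      λ { zero zero → mk⇔ (λ _ → ≈.refl) (λ _ → refl)
        ; zero (suc w) → mk⇔ (λ ()) (λ 0≈w → contradiction (w , 0≈w) ¬∃)
        ; (suc v) zero → mk⇔ (λ ()) (λ v≈0 → contradiction (v , ≈.sym v≈0) ¬∃)
        ; (suc v) (suc w) → ⇔-trans (mk⇔ Fin.suc-injective (cong suc)) (kerP v w) }
  where module ≈ = IsDecEquivalence ≈-dec

kernel-isDecEquivalence : ∀ {n} (P : Partition n) → IsDecEquivalence (Kernel P)
kernel-isDecEquivalence P = On.isDecEquivalence (part P) Fin.≡-isDecEquivalence

-- Representatives of different parts of the coarser `Q` lie in different parts of `P`.
kernel⊆⇒size≥ : ∀ {n} (P Q : Partition n) → (∀ v w → Kernel P v w → Kernel Q v w) →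
                size Q ≤ size P
kernel⊆⇒size≥ P Q P⊆Q = Fin.injective⇒≤ {f = part P ∘ rep} λ {i} {j} eq →
  trans (sym (proj₂ (surjective Q i)))
    (trans (P⊆Q (rep i) (rep j) eq) (proj₂ (surjective Q j)))
  where
  rep : Fin (size Q) → Fin _
  rep i = proj₁ (surjective Q i)

kernel⇒size : ∀ {n} (P Q : Partition n) → (∀ v w → Kernel P v w ⇔ Kernel Q v w) →
              size P ≡ size Q
kernel⇒size P Q P⇔Q = ℕ.≤-antisym
  (kernel⊆⇒size≥ Q P (λ v w → from (P⇔Q v w)))
  (kernel⊆⇒size≥ P Q (λ v w → to (P⇔Q v w)))

module _ (H : Hypergraph) where
  open Hypergraph H

  -- Crossing expressed through two vertices instead of two part numbers, so that it depends on the
  -- kernel alone.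
  Separates : Partition nV → Fin nE → Set
  Separates P e = ∃₂ λ v w → v ∈ edge e × w ∈ edge e × ¬ Kernel P v w

  crosses⇔separates : ∀ P e → Crosses H P e ⇔ Separates P e
  crosses⇔separates P e = mk⇔
    (λ { (_ , _ , i≢j , (v , v∈ , refl) , (w , w∈ , refl)) → v , w , v∈ , w∈ , i≢j })
    (λ (v , w , v∈ , w∈ , v≁w) → part P v , part P w , v≁w , (v , v∈ , refl) , (w , w∈ , refl))

  ∈δ⇔separates : ∀ P {e} → e ∈ δ H P ⇔ Separates P e
  ∈δ⇔separates P {e} = ⇔-trans
    (mk⇔ (∈-tabulate-does⁻ (crosses? H P)) (∈-tabulate-does⁺ (crosses? H P)))
    (crosses⇔separates P e)

  δ-cong : ∀ P Q → (∀ v w → Kernel P v w ⇔ Kernel Q v w) → δ H P ≡ δ H Q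
  δ-cong P Q P⇔Q = ⊆-antisym (δ⊆ P Q (λ v w → from (P⇔Q v w))) (δ⊆ Q P (λ v w → to (P⇔Q v w)))
    where
    δ⊆ : ∀ P Q → (∀ v w → Kernel Q v w → Kernel P v w) → δ H P ⊆ δ H Q
    δ⊆ P Q Q⊆P e∈ = let v , w , v∈ , w∈ , v≁w = to (∈δ⇔separates P) e∈ in
      from (∈δ⇔separates Q) (v , w , v∈ , w∈ , v≁w ∘ Q⊆P v w)

  ratio-cong : ∀ P Q 2≤k 2≤l → size P ≡ size Q → δ H P ≡ δ H Q → ratio H P 2≤k ≡ ratio H Q 2≤l
  ratio-cong P Q 2≤k 2≤l size≡ δ≡ =
    ℚ./-cong {ℤ.+ ∣ δ H P ∣} {size P ∸ 1} {ℤ.+ ∣ δ H Q ∣} {size Q ∸ 1}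
      {{ℕ.>-nonZero (ℕ.m<n⇒0<n∸m 2≤k)}} {{ℕ.>-nonZero (ℕ.m<n⇒0<n∸m 2≤l)}}
      (cong (λ F → ℤ.+ ∣ F ∣) δ≡) (cong (_∸ 1) size≡)

  -- Any competitor has the kernel of some listed partition, and the ratio is determined by the
  -- kernel.
  strength-from-list : ∀ P 2≤k →
    (∀ {Q} → Q ∈ₗ partitions nV → ∀ 2≤l → ratio H P 2≤k ℚ.≤ ratio H Q 2≤l) →
    IsStrength H (ratio H P 2≤k)
  strength-from-list P 2≤k min = (P , 2≤k , refl) , λ q (Q , 2≤l , q≡) →
    let R , R∈ , R⇔Q = partitions-complete (kernel-isDecEquivalence Q)
        size≡ = kernel⇒size R Q R⇔Q
        2≤r = subst (2 ≤_) (sym size≡) 2≤l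
    in subst (ratio H P 2≤k ℚ.≤_)
         (trans (ratio-cong R Q 2≤r 2≤l size≡ (δ-cong R Q R⇔Q)) (sym q≡)) (min R∈ 2≤r)

  ∃strength : 2 ≤ nV → ∃[ s ] IsStrength H s
  ∃strength 2≤n = Sum.[ (λ none → contradiction 2≤r (All.lookup none R∈))
                      , (λ (P , 2≤k , min) → ratio H P 2≤k , strength-from-list P 2≤k min) ]′
    (argmin (λ P → 2 ℕ.≤? size P) ℕ.≤-irrelevant (ratio H) (partitions nV))
    where
    discrete = partitions-complete {nV} Fin.≡-isDecEquivalence
    R = proj₁ discrete
    R∈ = proj₁ (proj₂ discrete)
    -- The kernel of `R` is equality, so `part R` is injective and `R` has at least `nV` parts; the
    -- search is therefore over a nonempty set.
    2≤r : 2 ≤ size R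
    2≤r = ℕ.≤-trans 2≤n (Fin.injective⇒≤ {f = part R} (to (proj₂ (proj₂ discrete) _ _)))

-- Hyperforests and tight sets

+-∑≤∑ : ∀ {k} (f g : Fin k → ℕ) → (∀ i → ℕ.suc (f i) ≤ g i) → k + ℕΣ.sum f ≤ ℕΣ.sum g
+-∑≤∑ {ℕ.zero} f g f<g = z≤n
+-∑≤∑ {ℕ.suc k} f g f<g = begin
  ℕ.suc (k + (f zero + ℕΣ.sum (f ∘ suc)))  ≡⟨ shuffle k (f zero) (ℕΣ.sum (f ∘ suc)) ⟩
  ℕ.suc (f zero) + (k + ℕΣ.sum (f ∘ suc))
    ≤⟨ ℕ.+-mono-≤ (f<g zero) (+-∑≤∑ (f ∘ suc) (g ∘ suc) (f<g ∘ suc)) ⟩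
  ℕΣ.sum g ∎
  where
  open ℕ.≤-Reasoning
  open ℕ.+-*-Solver
  shuffle : ∀ a b c → ℕ.suc (a + (b + c)) ≡ ℕ.suc b + (a + c)
  shuffle = solve 3 (λ a b c → con 1 :+ (a :+ (b :+ c)) := (con 1 :+ b) :+ (a :+ c)) refl

∑≤+-∑ : ∀ {k} (f g : Fin k → ℕ) → (∀ i → g i ≤ ℕ.suc (f i)) → ℕΣ.sum g ≤ k + ℕΣ.sum f
∑≤+-∑ {ℕ.zero} f g g≤ = z≤n
∑≤+-∑ {ℕ.suc k} f g g≤ = begin
  ℕΣ.sum g ≤⟨ ℕ.+-mono-≤ (g≤ zero) (∑≤+-∑ (f ∘ suc) (g ∘ suc) (g≤ ∘ suc)) ⟩
  ℕ.suc (f zero) + (k + ℕΣ.sum (f ∘ suc))  ≡⟨ shuffle (f zero) k (ℕΣ.sum (f ∘ suc)) ⟩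
  ℕ.suc (k + (f zero + ℕΣ.sum (f ∘ suc)))  ∎
  where
  open ℕ.≤-Reasoning
  open ℕ.+-*-Solver
  shuffle : ∀ b a c → ℕ.suc b + (a + c) ≡ ℕ.suc (a + (b + c))
  shuffle = solve 3 (λ b a c → (con 1 :+ b) :+ (a :+ c) := con 1 :+ (a :+ (b :+ c))) refl

-- Only `m` has to be positive: for `n = 0` truncation leaves the right side as it was.
∸1-mono-+ : ∀ m n {a b} → 0 < m → m + a ≤ n + b → m ∸ 1 + a ≤ n ∸ 1 + b
∸1-mono-+ (ℕ.suc m) ℕ.zero _ m+a≤b = ℕ.≤-trans (ℕ.n≤1+n _) m+a≤b
∸1-mono-+ (ℕ.suc m) (ℕ.suc n) _ (s≤s m+a≤n+b) = m+a≤n+b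

x∈p⇒0<∣p∣ : ∀ {n} {p : Subset n} {x} → x ∈ p → 0 < ∣ p ∣
x∈p⇒0<∣p∣ {p = p} {x} x∈p = subst (_≤ ∣ p ∣) (∣⁅x⁆∣≡1 x) (p⊆q⇒∣p∣≤∣q∣ λ y∈ →
  subst (_∈ p) (sym (x∈⁅y⁆⇒x≡y x y∈)) x∈p)

0<∣p∣⇒nonempty : ∀ {n} (p : Subset n) → 0 < ∣ p ∣ → Nonempty p
0<∣p∣⇒nonempty {n} p 0<∣p∣ with nonempty? p
... | yes ne = ne
... | no empty = contradiction (trans (cong ∣_∣ (Empty-unique empty)) (∣⊥∣≡0 n)) (ℕ.>⇒≢ 0<∣p∣)

block : ∀ {n} (P : Partition n) → Fin (size P) → Subset n
block P i = Vec.tabulate λ v → does (part P v Fin.≟ i)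

∈block⇔ : ∀ {n} (P : Partition n) {i v} → v ∈ block P i ⇔ part P v ≡ i
∈block⇔ P {i} = mk⇔ (∈-tabulate-does⁻ λ v → part P v Fin.≟ i) (∈-tabulate-does⁺ λ v → part P v Fin.≟ i)

block-nonempty : ∀ {n} (P : Partition n) i → Nonempty (block P i)
block-nonempty P i = let v , eq = surjective P i in v , from (∈block⇔ P) eq

n≡∑∣block∣ : ∀ {n} (P : Partition n) → n ≡ ℕΣ.sum (∣_∣ ∘ block P)
n≡∑∣block∣ {n} P = trans (sym (∣⊤∣≡n n)) (∣p∣≡∑∣q∣ ⊤ (block P)
  (λ {v} _ → part P v , from (∈block⇔ P) refl) (λ _ _ → ∈⊤)
  (λ v∈ v∈′ → trans (sym (to (∈block⇔ P) v∈)) (to (∈block⇔ P) v∈′)))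

module _ (H : Hypergraph) where
  open Hypergraph H

  ∈edgesWithin⁺ : ∀ {X e} → edge e ⊆ X → e ∈ edgesWithin H X
  ∈edgesWithin⁺ {X} {e} e⊆X =
    ∈-tabulate-does⁺ {P = λ e → edge e ⊆ X} (λ e → edge e ⊆? X) {e} e⊆X

  ∈edgesWithin⁻ : ∀ {X e} → e ∈ edgesWithin H X → edge e ⊆ X
  ∈edgesWithin⁻ {X} {e} e∈ =
    ∈-tabulate-does⁻ {P = λ e → edge e ⊆ X} (λ e → edge e ⊆? X) {e} e∈

  edge-nonempty : ∀ e → Nonempty (edge e)
  edge-nonempty e = 0<∣p∣⇒nonempty (edge e) (ℕ.<-trans ℕ.z<s (edge-≥2 e))

  -- A hyperedge outside `δ H P` lies inside the block of any of its vertices. Being nonempty, it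
  -- lies inside only one block, so the pieces are disjoint.
  ∣F∣≡∣F∩δ∣+∑ : ∀ F P → ∣ F ∣ ≡ ∣ F ∩ δ H P ∣ + ℕΣ.sum λ i → ∣ F ∩ edgesWithin H (block P i) ∣
  ∣F∣≡∣F∩δ∣+∑ F P = trans (∣p∣≡∣p∩q∣+∣p─q∣ F (δ H P)) (cong (∣ F ∩ δ H P ∣ +_)
    (∣p∣≡∑∣q∣ (F ─ δ H P) (λ i → F ∩ edgesWithin H (block P i)) cover within disjoint))
    where
    ⊆block : ∀ {e i} → e ∈ F ∩ edgesWithin H (block P i) → ∀ {v} → v ∈ edge e → part P v ≡ i
    ⊆block e∈ v∈e =
      to (∈block⇔ P) (∈edgesWithin⁻ (p∩q⊆q F (edgesWithin H (block P _)) e∈) v∈e)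

    cover : ∀ {e} → e ∈ F ─ δ H P → ∃[ i ] e ∈ F ∩ edgesWithin H (block P i)
    cover {e} e∈ = part P v , x∈p∩q⁺ (p─q⊆p F (δ H P) e∈ , ∈edgesWithin⁺ e⊆)
      where
      v = proj₁ (edge-nonempty e)
      e⊆ : edge e ⊆ block P (part P v)
      e⊆ {w} w∈ with part P w Fin.≟ part P v
      ... | yes eq = from (∈block⇔ P) eq
      ... | no neq = contradiction
            (from (∈δ⇔separates H P) (w , v , w∈ , proj₂ (edge-nonempty e) , neq))
            (x∈p─q⇒x∉q F (δ H P) e∈)

    within : ∀ i → F ∩ edgesWithin H (block P i) ⊆ F ─ δ H P
    within i e∈ = x∈p∧x∉q⇒x∈p─q (p∩q⊆p F _ e∈) λ e∈δ →
      let v , w , v∈ , w∈ , v≁w = to (∈δ⇔separates H P) e∈δ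
      in v≁w (trans (⊆block e∈ v∈) (sym (⊆block e∈ w∈)))

    disjoint : ∀ {e i j} → e ∈ F ∩ edgesWithin H (block P i) →
               e ∈ F ∩ edgesWithin H (block P j) → i ≡ j
    disjoint {e} e∈ e∈′ = let v , v∈ = edge-nonempty e in trans (sym (⊆block e∈ v∈)) (⊆block e∈′ v∈)

  forest-bound : ∀ F {X} → IsHyperforest H F → Nonempty X →
                 ℕ.suc ∣ F ∩ edgesWithin H X ∣ ≤ ∣ X ∣
  forest-bound F {X} forest (v , v∈) = begin
    ℕ.suc ∣ F ∩ edgesWithin H X ∣  ≤⟨ s≤s (forest X (v , v∈)) ⟩
    ℕ.suc (∣ X ∣ ∸ 1)  ≡⟨ ℕ.m+[n∸m]≡n (x∈p⇒0<∣p∣ v∈) ⟩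
    ∣ X ∣ ∎
    where open ℕ.≤-Reasoning

  -- Summing the forest bound over the blocks gives `size P + inner ≤ nV`, and `nV` is one more than
  -- the size of `T`, which splits as crossing hyperedges plus `inner`.
  hypertree-crossings : ∀ T → IsHypertree H T → ∀ P → size P ∸ 1 ≤ ∣ T ∩ δ H P ∣
  hypertree-crossings T (forest , ∣T∣≡) P = ℕ.∸-monoˡ-≤ 1 (ℕ.+-cancelʳ-≤ inner _ _ (begin
    size P + inner  ≤⟨ +-∑≤∑ _ _ (λ i → forest-bound T forest (block-nonempty P i)) ⟩
    ℕΣ.sum (∣_∣ ∘ block P)  ≡⟨ n≡∑∣block∣ P ⟨
    nV  ≡⟨ ℕ.m+[n∸m]≡n nonempty ⟨
    ℕ.suc (nV ∸ 1)  ≡⟨ cong ℕ.suc ∣T∣≡ ⟨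
    ℕ.suc ∣ T ∣  ≡⟨ cong ℕ.suc (∣F∣≡∣F∩δ∣+∑ T P) ⟩
    ℕ.suc ∣ T ∩ δ H P ∣ + inner  ∎))
    where
    open ℕ.≤-Reasoning
    inner = ℕΣ.sum λ i → ∣ T ∩ edgesWithin H (block P i) ∣

  -- For a hyperforest the opposite inequality always holds, so this says that `X` contains exactly
  -- one hyperedge of `F` fewer than it has vertices.
  Tight : Subset nE → Subset nV → Set
  Tight F X = Nonempty X × ∣ X ∣ ≤ ℕ.suc ∣ F ∩ edgesWithin H X ∣

  tight? : ∀ F X → Dec (Tight F X)
  tight? F X = nonempty? X ×-dec (∣ X ∣ ℕ.≤? ℕ.suc ∣ F ∩ edgesWithin H X ∣)

  -- When `F` is a hyperforest and `e` is new, these are the hyperedges that cannot be added: the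
  -- tight set `X` would contain too many.
  Spanned : Subset nE → Fin nE → Set
  Spanned F e = ∃[ X ] (Tight F X × edge e ⊆ X)

  spanned? : ∀ F e → Dec (Spanned F e)
  spanned? F e = anySubset? λ X → tight? F X ×-dec (edge e ⊆? X)

  Tight-mono : ∀ F G {X} → F ⊆ G → Tight F X → Tight G X
  Tight-mono F G {X} F⊆G (ne , ∣X∣≤) = ne , ℕ.≤-trans ∣X∣≤ (s≤s (p⊆q⇒∣p∣≤∣q∣ λ e∈ →
    let e∈F , e∈X = x∈p∩q⁻ F (edgesWithin H X) e∈ in x∈p∩q⁺ (F⊆G e∈F , e∈X)))

  Spanned-mono : ∀ F G {e} → F ⊆ G → Spanned F e → Spanned G e
  Spanned-mono F G F⊆G (X , tight , e⊆X) = X , Tight-mono F G F⊆G tight , e⊆X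

  singleton-tight : ∀ F v → Tight F ⁅ v ⁆
  singleton-tight F v = (v , x∈⁅x⁆ v) , ℕ.≤-trans (ℕ.≤-reflexive (∣⁅x⁆∣≡1 v)) (s≤s z≤n)

  -- Uncrossing: the number of vertices is modular and the number of hyperedges of `F` inside a set
  -- is supermodular. The common vertex `v` makes `X ∩ Y` nonempty, so the forest bound applies to
  -- it and all the slack is forced out of `X ∪ Y`.
  ∪-tight : ∀ F {X Y v} → IsHyperforest H F → v ∈ X → v ∈ Y → Tight F X → Tight F Y → Tight F (X ∪ Y)
  ∪-tight F {X} {Y} {v} forest v∈X v∈Y (_ , ∣X∣≤) (_ , ∣Y∣≤) =
    (v , p⊆p∪q Y v∈X) , ℕ.+-cancelʳ-≤ ∣ X ∩ Y ∣ _ _ (begin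
      ∣ X ∪ Y ∣ + ∣ X ∩ Y ∣  ≡⟨ ∣p∪q∣+∣p∩q∣≡∣p∣+∣q∣ X Y ⟩
      ∣ X ∣ + ∣ Y ∣  ≤⟨ ℕ.+-mono-≤ ∣X∣≤ ∣Y∣≤ ⟩
      ℕ.suc ∣ F[ X ] ∣ + ℕ.suc ∣ F[ Y ] ∣  ≡⟨ ℕ.+-suc (ℕ.suc ∣ F[ X ] ∣) ∣ F[ Y ] ∣ ⟩
      2 + (∣ F[ X ] ∣ + ∣ F[ Y ] ∣)  ≡⟨ cong (2 +_) (∣p∪q∣+∣p∩q∣≡∣p∣+∣q∣ F[ X ] F[ Y ]) ⟨
      2 + (∣ F[ X ] ∪ F[ Y ] ∣ + ∣ F[ X ] ∩ F[ Y ] ∣)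
        ≤⟨ ℕ.+-monoʳ-≤ 2 (ℕ.+-mono-≤ (p⊆q⇒∣p∣≤∣q∣ ∪⊆) (p⊆q⇒∣p∣≤∣q∣ ∩⊆)) ⟩
      2 + (∣ F[ X ∪ Y ] ∣ + ∣ F[ X ∩ Y ] ∣)  ≡⟨ ℕ.+-suc (ℕ.suc ∣ F[ X ∪ Y ] ∣) ∣ F[ X ∩ Y ] ∣ ⟨
      ℕ.suc ∣ F[ X ∪ Y ] ∣ + ℕ.suc ∣ F[ X ∩ Y ] ∣
        ≤⟨ ℕ.+-monoʳ-≤ (ℕ.suc ∣ F[ X ∪ Y ] ∣) (forest-bound F forest (v , x∈p∩q⁺ (v∈X , v∈Y))) ⟩
      ℕ.suc ∣ F[ X ∪ Y ] ∣ + ∣ X ∩ Y ∣  ∎)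
    where
    open ℕ.≤-Reasoning
    F[_] : Subset nV → Subset nE
    F[ Z ] = F ∩ edgesWithin H Z
    split : ∀ {Z e} → e ∈ F[ Z ] → e ∈ F × edge e ⊆ Z
    split {Z} e∈ = let e∈F , e∈Z = x∈p∩q⁻ F (edgesWithin H Z) e∈ in e∈F , ∈edgesWithin⁻ e∈Z
    ∪⊆ : F[ X ] ∪ F[ Y ] ⊆ F[ X ∪ Y ]
    ∪⊆ e∈ with x∈p∪q⁻ F[ X ] F[ Y ] e∈
    ... | inj₁ e∈X = let e∈F , e⊆X = split e∈X in
          x∈p∩q⁺ (e∈F , ∈edgesWithin⁺ (⊆-trans e⊆X (p⊆p∪q Y)))
    ... | inj₂ e∈Y = let e∈F , e⊆Y = split e∈Y in
          x∈p∩q⁺ (e∈F , ∈edgesWithin⁺ (⊆-trans e⊆Y (q⊆p∪q X Y)))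
    ∩⊆ : F[ X ] ∩ F[ Y ] ⊆ F[ X ∩ Y ]
    ∩⊆ e∈ =
      let e∈X , e∈Y = x∈p∩q⁻ F[ X ] F[ Y ] e∈
          e∈F , e⊆X = split e∈X
          _ , e⊆Y = split e∈Y
      in x∈p∩q⁺ (e∈F , ∈edgesWithin⁺ λ v∈ → x∈p∩q⁺ (e⊆X v∈ , e⊆Y v∈))

  Together : Subset nE → Fin nV → Fin nV → Set
  Together F v w = ∃[ X ] (Tight F X × v ∈ X × w ∈ X)

  together? : ∀ F v w → Dec (Together F v w)
  together? F v w = anySubset? λ X → tight? F X ×-dec (v ∈? X ×-dec w ∈? X)

  together-isDecEquivalence : ∀ F → IsHyperforest H F → IsDecEquivalence (Together F)
  together-isDecEquivalence F forest = record
    { isEquivalence = record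
      { refl = λ {v} → ⁅ v ⁆ , singleton-tight F v , x∈⁅x⁆ v , x∈⁅x⁆ v
      ; sym = λ (X , tight , v∈ , w∈) → X , tight , w∈ , v∈
      ; trans = λ (X , tightX , u∈X , v∈X) (Y , tightY , v∈Y , w∈Y) →
          X ∪ Y , ∪-tight F forest v∈X v∈Y tightX tightY , p⊆p∪q Y u∈X , q⊆p∪q X Y w∈Y
      }
    ; _≟_ = together? F
    }

  -- Tight sets through `v` are united one after another, keeping `v` as the common vertex. With
  -- `ws` listing all vertices this shows that the whole class of `v` is tight.
  tight-hull : ∀ F → IsHyperforest H F → ∀ v ws →
    ∃[ X ] (Tight F X × v ∈ X × (∀ {w} → w ∈ₗ ws → Together F v w → w ∈ X))
  tight-hull F forest v [] = ⁅ v ⁆ , singleton-tight F v , x∈⁅x⁆ v , λ ()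
  tight-hull F forest v (w ∷ ws) with tight-hull F forest v ws | together? F v w
  ... | X , tight , v∈X , hull | no ¬v~w =
        X , tight , v∈X , λ { (here refl) v~w → contradiction v~w ¬v~w
                            ; (there w∈ws) → hull w∈ws }
  ... | X , tightX , v∈X , hull | yes (Y , tightY , v∈Y , w∈Y) =
        X ∪ Y , ∪-tight F forest v∈X v∈Y tightX tightY , p⊆p∪q Y v∈X ,
        λ { (here refl) _ → q⊆p∪q X Y w∈Y
          ; (there w∈ws) v~w → p⊆p∪q Y (hull w∈ws v~w) }

  -- The parts are the classes of `Together F`, which are the maximal tight sets. Tightness of every
  -- block turns the block count into the inequality, and a spanned hyperedge sits inside one class.
  tight-partition : ∀ F → IsHyperforest H F →
    ∃[ P ] (nV + ∣ F ∩ δ H P ∣ ≤ size P + ∣ F ∣ × (∀ {e} → Spanned F e → e ∉ δ H P))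
  tight-partition F forest with partitions-complete (together-isDecEquivalence F forest)
  ... | P , _ , kerP = P , count , uncrossed
    where
    block-tight : ∀ i → Tight F (block P i)
    block-tight i with surjective P i
    ... | v , refl with tight-hull F forest v (allFin nV)
    -- The hull is exactly the class of `v`, since `X` itself witnesses that each of its vertices is
    -- together with `v`.
    ...   | X , tight , v∈X , hull = subst (Tight F) (⊆-antisym
              (λ {w} w∈X → from (∈block⇔ P) (from (kerP w v) (X , tight , w∈X , v∈X)))
              (λ {w} w∈ → hull (∈-tabulate⁺ w) (to (kerP v w) (sym (to (∈block⇔ P) w∈)))))
            tight

    inner = ℕΣ.sum λ i → ∣ F ∩ edgesWithin H (block P i) ∣

    count : nV + ∣ F ∩ δ H P ∣ ≤ size P + ∣ F ∣
    count = begin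
      nV + ∣ F ∩ δ H P ∣  ≡⟨ cong (_+ ∣ F ∩ δ H P ∣) (n≡∑∣block∣ P) ⟩
      ℕΣ.sum (∣_∣ ∘ block P) + ∣ F ∩ δ H P ∣
        ≤⟨ ℕ.+-monoˡ-≤ ∣ F ∩ δ H P ∣ (∑≤+-∑ _ _ (proj₂ ∘ block-tight)) ⟩
      (size P + inner) + ∣ F ∩ δ H P ∣  ≡⟨ ℕ.+-assoc (size P) inner ∣ F ∩ δ H P ∣ ⟩
      size P + (inner + ∣ F ∩ δ H P ∣)  ≡⟨ cong (size P +_) (ℕ.+-comm inner ∣ F ∩ δ H P ∣) ⟩
      size P + (∣ F ∩ δ H P ∣ + inner)  ≡⟨ cong (size P +_) (∣F∣≡∣F∩δ∣+∑ F P) ⟨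
      size P + ∣ F ∣  ∎
      where open ℕ.≤-Reasoning

    uncrossed : ∀ {e} → Spanned F e → e ∉ δ H P
    uncrossed (X , tight , e⊆X) e∈δ =
      let v , w , v∈ , w∈ , v≁w = to (∈δ⇔separates H P) e∈δ
      in v≁w (from (kerP v w) (X , tight , e⊆X v∈ , e⊆X w∈))

  -- The invariant of the scan: a hyperedge has been accepted, is blocked by a tight set, or is
  -- still waiting in `es`.
  Covered : Subset nE → List (Fin nE) → Set
  Covered F es = ∀ e → e ∈ F ⊎ Spanned F e ⊎ e ∈ₗ es

  -- In the partition into maximal tight sets no spanned hyperedge crosses, so by the invariant
  -- every crossing one is in `F` or in `es`.
  covered-bounds : ∀ F es → IsHyperforest H F → Covered F es →
    ∃[ P ] (nV ∸ 1 + ∣ F ∩ δ H P ∣ ≤ size P ∸ 1 + ∣ F ∣ × ∣ δ H P ∣ ≤ ∣ F ∩ δ H P ∣ + length es)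
  covered-bounds F es forest covered =
    let P , count , uncrossed = tight-partition F forest
    in P , ∸1-mono-+ nV (size P) nonempty count , ∣p∣≤∣q∣+length (δ H P) (F ∩ δ H P) es λ {e} e∈δ → Sum.[
      (λ e∈F → inj₁ (x∈p∩q⁺ (e∈F , e∈δ))) ,
      Sum.[ (λ spanned → contradiction e∈δ (uncrossed spanned)) , inj₂ ]′ ]′ (covered e)

  forest-extend : ∀ F e → IsHyperforest H F → ¬ Spanned F e → IsHyperforest H (F ∪ ⁅ e ⁆)
  forest-extend F e forest ¬spanned X ne with edge e ⊆? X
  ... | no e⊈X = ℕ.≤-trans (p⊆q⇒∣p∣≤∣q∣ shrink) (forest X ne)
    where
    shrink : (F ∪ ⁅ e ⁆) ∩ edgesWithin H X ⊆ F ∩ edgesWithin H X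
    shrink {f} f∈ with x∈p∩q⁻ (F ∪ ⁅ e ⁆) (edgesWithin H X) f∈
    ... | f∈F∪e , f∈X with x∈p∪q⁻ F ⁅ e ⁆ f∈F∪e
    ...   | inj₁ f∈F = x∈p∩q⁺ (f∈F , f∈X)
    ...   | inj₂ f∈e with x∈⁅y⁆⇒x≡y e f∈e
    ...     | refl = contradiction (λ {v} → ∈edgesWithin⁻ f∈X {v}) e⊈X
  -- Since `e` is not spanned, `X` is not tight, which leaves room for one more hyperedge inside it.
  ... | yes e⊆X = ℕ.≤-trans
        (ℕ.≤-trans (p⊆q⇒∣p∣≤∣q∣ grow) (∣p∪⁅x⁆∣≤suc∣p∣ (F ∩ edgesWithin H X) e))
        (ℕ.∸-monoˡ-≤ 1 (ℕ.≰⇒> λ ∣X∣≤ → ¬spanned (X , (ne , ∣X∣≤) , e⊆X)))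
    where
    grow : (F ∪ ⁅ e ⁆) ∩ edgesWithin H X ⊆ (F ∩ edgesWithin H X) ∪ ⁅ e ⁆
    grow f∈ with x∈p∩q⁻ (F ∪ ⁅ e ⁆) (edgesWithin H X) f∈
    ... | f∈F∪e , f∈X with x∈p∪q⁻ F ⁅ e ⁆ f∈F∪e
    ...   | inj₁ f∈F = p⊆p∪q ⁅ e ⁆ (x∈p∩q⁺ (f∈F , f∈X))
    ...   | inj₂ f∈e = q⊆p∪q (F ∩ edgesWithin H X) ⁅ e ⁆ f∈e

  ⊥-forest : IsHyperforest H ⊥
  ⊥-forest X _ = subst (_≤ ∣ X ∣ ∸ 1) (sym (trans (cong ∣_∣ (∩-zeroˡ (edgesWithin H X))) (∣⊥∣≡0 nE))) z≤n

  ∣forest∣<nV : ∀ F → IsHyperforest H F → ℕ.suc ∣ F ∣ ≤ nV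
  ∣forest∣<nV F forest = begin
    ℕ.suc ∣ F ∣  ≤⟨ s≤s (p⊆q⇒∣p∣≤∣q∣ {p = F} λ {e} e∈F → x∈p∩q⁺ (e∈F , ∈edgesWithin⁺ {⊤} {e} λ _ → ∈⊤)) ⟩
    ℕ.suc ∣ F ∩ edgesWithin H ⊤ ∣  ≤⟨ forest-bound F forest ne ⟩
    ∣ ⊤ {nV} ∣  ≡⟨ ∣⊤∣≡n nV ⟩
    nV ∎
    where
    open ℕ.≤-Reasoning
    ne : Nonempty (⊤ {nV})
    ne = 0<∣p∣⇒nonempty ⊤ (subst (0 <_) (sym (∣⊤∣≡n nV)) nonempty)

  -- With nothing left to scan, all crossing hyperedges of the tight partition belong to `F`.
  -- Partition-connectedness supplies `size P ∸ 1` of them, which forces `F` to be spanning.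
  covered-forest-hypertree : PartitionConnected H → ∀ F → IsHyperforest H F → Covered F [] →
                             IsHypertree H F
  covered-forest-hypertree connected F forest covered =
    forest , ℕ.≤-antisym (ℕ.∸-monoˡ-≤ 1 (∣forest∣<nV F forest))
      (let P , count , ∣δ∣≤ = covered-bounds F [] forest covered in
       spanning P count (ℕ.≤-trans (connected P) ∣δ∣≤))
    where
    open ℕ.≤-Reasoning
    spanning : ∀ P → nV ∸ 1 + ∣ F ∩ δ H P ∣ ≤ size P ∸ 1 + ∣ F ∣ →
               size P ∸ 1 ≤ ∣ F ∩ δ H P ∣ + 0 → nV ∸ 1 ≤ ∣ F ∣
    spanning P count size≤ = ℕ.+-cancelʳ-≤ ∣ F ∩ δ H P ∣ _ _ (begin
      nV ∸ 1 + ∣ F ∩ δ H P ∣         ≤⟨ count ⟩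
      size P ∸ 1 + ∣ F ∣             ≤⟨ ℕ.+-monoˡ-≤ ∣ F ∣ size≤ ⟩
      ∣ F ∩ δ H P ∣ + 0 + ∣ F ∣      ≡⟨ cong (_+ ∣ F ∣) (ℕ.+-identityʳ ∣ F ∩ δ H P ∣) ⟩
      ∣ F ∩ δ H P ∣ + ∣ F ∣          ≡⟨ ℕ.+-comm ∣ F ∩ δ H P ∣ ∣ F ∣ ⟩
      ∣ F ∣ + ∣ F ∩ δ H P ∣          ∎)

-- Weights of edge sets

ι : ℕ → ℚ
ι n = ℤ.+ n ℚ./ 1

ι-+ : ∀ m n → ι (m + n) ≡ ι m ℚ.+ ι n
ι-+ m n = ℚ.toℚᵘ-injective (begin
  ℚ.toℚᵘ (ι (m + n))              ≈⟨ ℚ.toℚᵘ-fromℚᵘ (mkℚᵘ (ℤ.+ (m + n)) 0) ⟩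
  mkℚᵘ (ℤ.+ (m + n)) 0              ≈⟨ *≡* (eq (ℤ.+ m) (ℤ.+ n)) ⟩
  mkℚᵘ (ℤ.+ m) 0 ℚᵘ.+ mkℚᵘ (ℤ.+ n) 0  ≈⟨ ℚᵘ.+-cong (ℚ.toℚᵘ-fromℚᵘ (mkℚᵘ (ℤ.+ m) 0))
                                                    (ℚ.toℚᵘ-fromℚᵘ (mkℚᵘ (ℤ.+ n) 0)) ⟨
  ℚ.toℚᵘ (ι m) ℚᵘ.+ ℚ.toℚᵘ (ι n)      ≈⟨ ℚ.toℚᵘ-homo-+ (ι m) (ι n) ⟨
  ℚ.toℚᵘ (ι m ℚ.+ ι n)                  ∎)
  where
  open ℚᵘ.≃-Reasoning
  open ℤ.+-*-Solver
  eq : ∀ i j → (i ℤ.+ j) ℤ.* ℤ.1ℤ ≡ (i ℤ.* ℤ.1ℤ ℤ.+ j ℤ.* ℤ.1ℤ) ℤ.* ℤ.1ℤ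
  eq = solve 2 (λ i j → (i :+ j) :* con ℤ.1ℤ := (i :* con ℤ.1ℤ :+ j :* con ℤ.1ℤ) :* con ℤ.1ℤ) refl

ι-mono : ∀ {m n} → m ≤ n → ι m ℚ.≤ ι n
ι-mono {m} {n} m≤n = ℚ.toℚᵘ-cancel-≤ (begin
  ℚ.toℚᵘ (ι m)    ≃⟨ ℚ.toℚᵘ-fromℚᵘ (mkℚᵘ (ℤ.+ m) 0) ⟩
  mkℚᵘ (ℤ.+ m) 0  ≤⟨ *≤* (ℤ.*-monoʳ-≤-nonNeg ℤ.1ℤ (ℤ.+≤+ m≤n)) ⟩
  mkℚᵘ (ℤ.+ n) 0  ≃⟨ ℚ.toℚᵘ-fromℚᵘ (mkℚᵘ (ℤ.+ n) 0) ⟨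
  ℚ.toℚᵘ (ι n)    ∎)
  where open ℚᵘ.≤-Reasoning

ι-nonNeg : ∀ n → ℚ.NonNegative (ι n)
ι-nonNeg n = ℚ.nonNegative (ι-mono (ℕ.z≤n {n}))

ι-pos : ∀ n → .{{_ : ℕ.NonZero n}} → ℚ.Positive (ι n)
ι-pos (ℕ.suc n) = ℚ.positive (ℚ.<-≤-trans (ℚ.positive⁻¹ 1ℚ) (ι-mono (ℕ.s≤s (ℕ.z≤n {n}))))

n/k*ιk≡ιn : ∀ n k .{{_ : ℕ.NonZero k}} → (ℤ.+ n ℚ./ k) ℚ.* ι k ≡ ι n
n/k*ιk≡ιn n (ℕ.suc k) = ℚ.toℚᵘ-injective (begin
  ℚ.toℚᵘ ((ℤ.+ n ℚ./ ℕ.suc k) ℚ.* ι (ℕ.suc k))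
    ≈⟨ ℚ.toℚᵘ-homo-* (ℤ.+ n ℚ./ ℕ.suc k) (ι (ℕ.suc k)) ⟩
  ℚ.toℚᵘ (ℤ.+ n ℚ./ ℕ.suc k) ℚᵘ.* ℚ.toℚᵘ (ι (ℕ.suc k))
    ≈⟨ ℚᵘ.*-cong (ℚ.toℚᵘ-fromℚᵘ (mkℚᵘ (ℤ.+ n) k)) (ℚ.toℚᵘ-fromℚᵘ (mkℚᵘ (ℤ.+ ℕ.suc k) 0)) ⟩
  mkℚᵘ (ℤ.+ n) k ℚᵘ.* mkℚᵘ (ℤ.+ ℕ.suc k) 0
    ≈⟨ *≡* (trans (ℤ.*-identityʳ _) (cong (λ d → ℤ.+ n ℤ.* ℤ.+ d) (sym (ℕ.*-identityʳ (ℕ.suc k))))) ⟩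
  mkℚᵘ (ℤ.+ n) 0
    ≈⟨ ℚ.toℚᵘ-fromℚᵘ (mkℚᵘ (ℤ.+ n) 0) ⟨
  ℚ.toℚᵘ (ι n) ∎)
  where open ℚᵘ.≃-Reasoning

weight : ∀ {n} → Subset n → (Fin n → ℚ) → ℚ
weight []      ρ = 0ℚ
weight (b ∷ F) ρ = (if b then ρ zero else 0ℚ) ℚ.+ weight F (ρ ∘ suc)

weight-⊥ : ∀ {n} (ρ : Fin n → ℚ) → weight ⊥ ρ ≡ 0ℚ
weight-⊥ {ℕ.zero} ρ = refl
weight-⊥ {ℕ.suc n} ρ = trans (ℚ.+-identityˡ (weight {n} ⊥ (ρ ∘ suc))) (weight-⊥ (ρ ∘ suc))

weight-∪⁅⁆ : ∀ {n} (F : Subset n) e ρ → e ∉ F → weight (F ∪ ⁅ e ⁆) ρ ≡ weight F ρ ℚ.+ ρ e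
weight-∪⁅⁆ (inside ∷ F) zero ρ e∉F = contradiction here e∉F
weight-∪⁅⁆ (outside ∷ F) zero ρ e∉F = begin
  ρ zero ℚ.+ weight (F ∪ ⊥) (ρ ∘ suc)  ≡⟨ cong (λ G → ρ zero ℚ.+ weight G (ρ ∘ suc)) (∪-identityʳ F) ⟩
  ρ zero ℚ.+ weight F (ρ ∘ suc)        ≡⟨ ℚ.+-comm (ρ zero) (weight F (ρ ∘ suc)) ⟩
  weight F (ρ ∘ suc) ℚ.+ ρ zero        ≡⟨ cong (ℚ._+ ρ zero) (ℚ.+-identityˡ (weight F (ρ ∘ suc))) ⟨
  0ℚ ℚ.+ weight F (ρ ∘ suc) ℚ.+ ρ zero   ∎
  where open ≡-Reasoning
weight-∪⁅⁆ (inside ∷ F) (suc e) ρ e∉F =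
  trans (cong (ρ zero ℚ.+_) (weight-∪⁅⁆ F e (ρ ∘ suc) (e∉F ∘ there)))
    (sym (ℚ.+-assoc (ρ zero) (weight F (ρ ∘ suc)) (ρ (suc e))))
weight-∪⁅⁆ (outside ∷ F) (suc e) ρ e∉F =
  trans (cong (0ℚ ℚ.+_) (weight-∪⁅⁆ F e (ρ ∘ suc) (e∉F ∘ there)))
    (sym (ℚ.+-assoc 0ℚ (weight F (ρ ∘ suc)) (ρ (suc e))))

∣F∪⁅e⁆∣ : ∀ {n} (F : Subset n) e → e ∉ F → ∣ F ∪ ⁅ e ⁆ ∣ ≡ 1 + ∣ F ∣
∣F∪⁅e⁆∣ (inside ∷ F) zero e∉F = contradiction here e∉F
∣F∪⁅e⁆∣ (outside ∷ F) zero e∉F = cong (ℕ.suc ∘ ∣_∣) (∪-identityʳ F)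
∣F∪⁅e⁆∣ (inside ∷ F) (suc e) e∉F = cong ℕ.suc (∣F∪⁅e⁆∣ F e (e∉F ∘ there))
∣F∪⁅e⁆∣ (outside ∷ F) (suc e) e∉F = ∣F∪⁅e⁆∣ F e (e∉F ∘ there)

ι-suc-* : ∀ n c → ι (ℕ.suc n) ℚ.* c ≡ c ℚ.+ ι n ℚ.* c
ι-suc-* n c = begin
  ι (ℕ.suc n) ℚ.* c   ≡⟨ cong (ℚ._* c) (ι-+ 1 n) ⟩
  (1ℚ ℚ.+ ι n) ℚ.* c    ≡⟨ ℚ.*-distribʳ-+ c 1ℚ (ι n) ⟩
  1ℚ ℚ.* c ℚ.+ ι n ℚ.* c  ≡⟨ cong (ℚ._+ ι n ℚ.* c) (ℚ.*-identityˡ c) ⟩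
  c ℚ.+ ι n ℚ.* c       ∎
  where open ≡-Reasoning

weight-+const : ∀ {n} (F : Subset n) ρ c → weight F (λ e → ρ e ℚ.+ c) ≡ weight F ρ ℚ.+ ι ∣ F ∣ ℚ.* c
weight-+const [] ρ c = sym (trans (ℚ.+-identityˡ (0ℚ ℚ.* c)) (ℚ.*-zeroˡ c))
weight-+const (outside ∷ F) ρ c =
  trans (cong (0ℚ ℚ.+_) (weight-+const F (ρ ∘ suc) c))
    (sym (ℚ.+-assoc 0ℚ (weight F (ρ ∘ suc)) (ι ∣ F ∣ ℚ.* c)))
weight-+const (inside ∷ F) ρ c = begin
  (ρ zero ℚ.+ c) ℚ.+ weight F (λ e → ρ (suc e) ℚ.+ c)
    ≡⟨ cong ((ρ zero ℚ.+ c) ℚ.+_) (weight-+const F (ρ ∘ suc) c) ⟩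
  (ρ zero ℚ.+ c) ℚ.+ (weight F (ρ ∘ suc) ℚ.+ ι ∣ F ∣ ℚ.* c)
    ≡⟨ interchange (ρ zero) c (weight F (ρ ∘ suc)) (ι ∣ F ∣ ℚ.* c) ⟩
  (ρ zero ℚ.+ weight F (ρ ∘ suc)) ℚ.+ (c ℚ.+ ι ∣ F ∣ ℚ.* c)
    ≡⟨ cong ((ρ zero ℚ.+ weight F (ρ ∘ suc)) ℚ.+_) (ι-suc-* ∣ F ∣ c) ⟨
  (ρ zero ℚ.+ weight F (ρ ∘ suc)) ℚ.+ ι (ℕ.suc ∣ F ∣) ℚ.* c ∎
  where
  open ≡-Reasoning
  interchange : ∀ a b c d → (a ℚ.+ b) ℚ.+ (c ℚ.+ d) ≡ (a ℚ.+ c) ℚ.+ (b ℚ.+ d)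
  interchange = solve 4 (λ a b c d → (a :+ b) :+ (c :+ d) := (a :+ c) :+ (b :+ d)) refl
    where open ℚ.+-*-Solver

weight-indicator : ∀ {n} (F D : Subset n) c →
  weight F (λ e → if does (e ∈? D) then c else 0ℚ) ≡ ι ∣ F ∩ D ∣ ℚ.* c
weight-indicator [] [] c = sym (ℚ.*-zeroˡ c)
weight-indicator (outside ∷ F) (_ ∷ D) c =
  trans (ℚ.+-identityˡ (weight F (λ e → if does (e ∈? D) then c else 0ℚ))) (weight-indicator F D c)
weight-indicator (inside ∷ F) (outside ∷ D) c =
  trans (ℚ.+-identityˡ (weight F (λ e → if does (e ∈? D) then c else 0ℚ))) (weight-indicator F D c)
weight-indicator (inside ∷ F) (inside ∷ D) c =
  trans (cong (c ℚ.+_) (weight-indicator F D c)) (sym (ι-suc-* ∣ F ∩ D ∣ c))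

foldr-tabulate : ∀ {n} (ρ : Fin n → ℚ) → List.foldr ℚ._+_ 0ℚ (List.tabulate ρ) ≡ weight ⊤ ρ
foldr-tabulate {ℕ.zero} ρ = refl
foldr-tabulate {ℕ.suc n} ρ = cong (ρ zero ℚ.+_) (foldr-tabulate (ρ ∘ suc))

seq-sum : ∀ {n} (ρ : Vector ℝ n) k → seq (sum ρ) k ≡ weight ⊤ (λ e → seq (ρ e) k)
seq-sum {ℕ.zero} ρ k = refl
seq-sum {ℕ.suc n} ρ k = cong (seq (ρ zero) k ℚ.+_) (seq-sum (ρ ∘ suc) k)

indicator-* : ∀ {n} (F : Subset n) (ρ : Fin n → ℚ) k →
  weight ⊤ (λ e → seq (if does (e ∈? F) then 1ℝ else 0ℝ) k ℚ.* ρ e) ≡ weight F ρ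
indicator-* [] ρ k = refl
indicator-* (inside ∷ F) ρ k = cong₂ ℚ._+_ (ℚ.*-identityˡ (ρ zero)) (indicator-* F (ρ ∘ suc) k)
indicator-* (outside ∷ F) ρ k = cong₂ ℚ._+_ (ℚ.*-zeroˡ (ρ zero)) (indicator-* F (ρ ∘ suc) k)

seq-ᵀ : ∀ {n} (γ ρ : Vector ℝ n) k →
  seq (γ ᵀ ρ) k ≡ weight ⊤ (λ e → seq (γ e) k ℚ.* seq (ρ e) k)
seq-ᵀ γ ρ k = seq-sum (zipWith _*ᴿ_ γ ρ) k

-- The greedy hypertree

total : ∀ {n} → (Fin n → ℚ) → List (Fin n) → ℚ
total ρ es = List.foldr ℚ._+_ 0ℚ (List.map ρ es)

total-↭ : ∀ {n} (ρ : Fin n → ℚ) {es fs} → es ↭ fs → total ρ es ≡ total ρ fs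
total-↭ ρ es↭fs = Permutationₛ.foldr-commMonoid (setoid ℚ) ℚ.+-0-isCommutativeMonoid
  (↭⇒↭ₛ (map⁺ ρ es↭fs))

total-allFin : ∀ {n} (ρ : Fin n → ℚ) → total ρ (allFin n) ≡ weight ⊤ ρ
total-allFin ρ = trans (cong (List.foldr ℚ._+_ 0ℚ) (List.map-tabulate (λ e → e) ρ)) (foldr-tabulate ρ)

≤-by-cancel : ∀ r {p q} → p ℚ.+ r ℚ.≤ q ℚ.+ r → p ℚ.≤ q
≤-by-cancel r {p} {q} p+r≤q+r = subst₂ ℚ._≤_ (cancel p r) (cancel q r) (ℚ.+-monoˡ-≤ (ℚ.- r) p+r≤q+r)
  where
  open ℚ.+-*-Solver
  cancel : ∀ p r → (p ℚ.+ r) ℚ.- r ≡ p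
  cancel = solve 2 (λ p r → (p :+ r) :- r := p) refl

p≤q⇒0≤q-p : ∀ {p q} → p ℚ.≤ q → 0ℚ ℚ.≤ q ℚ.- p
p≤q⇒0≤q-p {p} {q} p≤q = subst (ℚ._≤ q ℚ.- p) (ℚ.+-inverseʳ p) (ℚ.+-monoˡ-≤ (ℚ.- p) p≤q)

0≤q-p⇒p≤q : ∀ {p q} → 0ℚ ℚ.≤ q ℚ.- p → p ℚ.≤ q
0≤q-p⇒p≤q {p} {q} 0≤q-p = ≤-by-cancel (ℚ.- p) (subst (ℚ._≤ q ℚ.- p) (sym (ℚ.+-inverseʳ p)) 0≤q-p)

module _ (H : Hypergraph) (s : ℚ) (1≤s : 1ℚ ℚ.≤ s)
         (s-bound : ∀ P → s ℚ.* ι (size P ∸ 1) ℚ.≤ ι ∣ δ H P ∣) where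
  open Hypergraph H

  instance
    s-nonNeg : ℚ.NonNegative s
    s-nonNeg = ℚ.nonNegative (ℚ.≤-trans (ℚ.nonNegative⁻¹ 1ℚ) 1≤s)

  -- The quantity |R| - s (|V| - 1 - |F|), with `es` listing R, arranged so that |F| is not
  -- subtracted in the naturals.
  slack : Subset nE → List (Fin nE) → ℚ
  slack F es = (ι (length es) ℚ.+ s ℚ.* ι ∣ F ∣) ℚ.- s ℚ.* ι (nV ∸ 1)

  slack-nonNeg : ∀ F es → IsHyperforest H F → Covered H F es → 0ℚ ℚ.≤ slack F es
  slack-nonNeg F es forest covered = p≤q⇒0≤q-p (bound (covered-bounds H F es forest covered))
    where
    bound : (∃[ P ] (nV ∸ 1 + ∣ F ∩ δ H P ∣ ≤ size P ∸ 1 + ∣ F ∣ ×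
                     ∣ δ H P ∣ ≤ ∣ F ∩ δ H P ∣ + length es)) →
            s ℚ.* ι (nV ∸ 1) ℚ.≤ ι (length es) ℚ.+ s ℚ.* ι ∣ F ∣
    -- The term `s ℚ.* ι c` is added on both sides to match `count`, and is recovered on the right
    -- from the `c` crossing hyperedges of `F`.
    bound (P , count , ∣δ∣≤) = ≤-by-cancel (s ℚ.* ι c) (begin
      s ℚ.* ι (nV ∸ 1) ℚ.+ s ℚ.* ι c  ≡⟨ s*ι-+ (nV ∸ 1) c ⟨
      s ℚ.* ι (nV ∸ 1 + c)  ≤⟨ ℚ.*-monoˡ-≤-nonNeg s (ι-mono count) ⟩
      s ℚ.* ι (size P ∸ 1 + ∣ F ∣)  ≡⟨ s*ι-+ (size P ∸ 1) ∣ F ∣ ⟩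
      s ℚ.* ι (size P ∸ 1) ℚ.+ s ℚ.* ι ∣ F ∣  ≤⟨ ℚ.+-monoˡ-≤ (s ℚ.* ι ∣ F ∣) (s-bound P) ⟩
      ι ∣ δ H P ∣ ℚ.+ s ℚ.* ι ∣ F ∣  ≤⟨ ℚ.+-monoˡ-≤ (s ℚ.* ι ∣ F ∣) (ι-mono ∣δ∣≤) ⟩
      ι (c + length es) ℚ.+ s ℚ.* ι ∣ F ∣  ≡⟨ cong (ℚ._+ s ℚ.* ι ∣ F ∣) (ι-+ c (length es)) ⟩
      (ι c ℚ.+ ι (length es)) ℚ.+ s ℚ.* ι ∣ F ∣
        ≤⟨ ℚ.+-monoˡ-≤ (s ℚ.* ι ∣ F ∣) (ℚ.+-monoˡ-≤ (ι (length es)) ιc≤s*ιc) ⟩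
      (s ℚ.* ι c ℚ.+ ι (length es)) ℚ.+ s ℚ.* ι ∣ F ∣
        ≡⟨ rotate (s ℚ.* ι c) (ι (length es)) (s ℚ.* ι ∣ F ∣) ⟩
      (ι (length es) ℚ.+ s ℚ.* ι ∣ F ∣) ℚ.+ s ℚ.* ι c  ∎)
      where
      open ℚ.≤-Reasoning
      c = ∣ F ∩ δ H P ∣
      s*ι-+ : ∀ m n → s ℚ.* ι (m + n) ≡ s ℚ.* ι m ℚ.+ s ℚ.* ι n
      s*ι-+ m n = trans (cong (s ℚ.*_) (ι-+ m n)) (ℚ.*-distribˡ-+ s (ι m) (ι n))
      rotate : ∀ x y z → (x ℚ.+ y) ℚ.+ z ≡ (y ℚ.+ z) ℚ.+ x
      rotate = solve 3 (λ x y z → (x :+ y) :+ z := (y :+ z) :+ x) refl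
        where open ℚ.+-*-Solver
      -- This is where `1ℚ ℚ.≤ s` enters: a crossing hyperedge of `F` counts once in the cut but is
      -- weighted by `s` in the slack.
      ιc≤s*ιc : ι c ℚ.≤ s ℚ.* ι c
      ιc≤s*ιc = subst (ℚ._≤ s ℚ.* ι c) (ℚ.*-identityˡ (ι c))
        (ℚ.*-monoʳ-≤-nonNeg (ι c) {{ι-nonNeg c}} 1≤s)

  module _ (connected : PartitionConnected H) (ρ : Fin nE → ℚ) where

    -- Abel summation along es: b bounds the remaining densities from below, and what has to be
    -- nonnegative is the slack.
    greedy : ∀ F es b → AllPairs (λ e f → ρ e ℚ.≤ ρ f) es → All (λ e → b ℚ.≤ ρ e) es →
             IsHyperforest H F → Covered H F es →
             ∃[ T ] (IsHypertree H T ×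
               b ℚ.* slack F es ℚ.≤ (total ρ es ℚ.+ s ℚ.* weight F ρ) ℚ.- s ℚ.* weight T ρ)
    -- At the end `F` has `nV ∸ 1` hyperedges, so the slack is zero and both sides vanish.
    greedy F [] b _ _ forest covered = F , hypertree , ℚ.≤-reflexive (trans
        (cong (λ m → b ℚ.* ((0ℚ ℚ.+ s ℚ.* ι m) ℚ.- s ℚ.* ι (nV ∸ 1))) (proj₂ hypertree))
        (vanish b (s ℚ.* ι (nV ∸ 1)) (s ℚ.* weight F ρ)))
      where
      hypertree = covered-forest-hypertree H connected F forest covered
      open ℚ.+-*-Solver
      vanish : ∀ b x y → b ℚ.* ((0ℚ ℚ.+ x) ℚ.- x) ≡ (0ℚ ℚ.+ y) ℚ.- y
      vanish = solve 3 (λ b x y → b :* ((con 0ℚ :+ x) :- x) := (con 0ℚ :+ y) :- y) refl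
    greedy F (e ∷ es) b (ρe≤es ∷ sorted) (b≤ρe ∷ _) forest covered =
      branch (e ∈? F) (spanned? H F e)
      where
      open ℚ.≤-Reasoning

      Claim = ∃[ T ] (IsHypertree H T ×
        b ℚ.* slack F (e ∷ es) ℚ.≤ (total ρ (e ∷ es) ℚ.+ s ℚ.* weight F ρ) ℚ.- s ℚ.* weight T ρ)

      -- Nonnegative slack allows the lower bound `b` to be replaced by `ρ e`, which by sortedness
      -- bounds the rest of the list.
      raise : b ℚ.* slack F (e ∷ es) ℚ.≤
              ρ e ℚ.* ((1ℚ ℚ.+ ι (length es) ℚ.+ s ℚ.* ι ∣ F ∣) ℚ.- s ℚ.* ι (nV ∸ 1))
      raise = begin
        b ℚ.* slack F (e ∷ es)
          ≤⟨ ℚ.*-monoʳ-≤-nonNeg (slack F (e ∷ es))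
               {{ℚ.nonNegative (slack-nonNeg F (e ∷ es) forest covered)}} b≤ρe ⟩
        ρ e ℚ.* slack F (e ∷ es)
          ≡⟨ cong (λ l → ρ e ℚ.* ((l ℚ.+ s ℚ.* ι ∣ F ∣) ℚ.- s ℚ.* ι (nV ∸ 1))) (ι-+ 1 (length es)) ⟩
        ρ e ℚ.* ((1ℚ ℚ.+ ι (length es) ℚ.+ s ℚ.* ι ∣ F ∣) ℚ.- s ℚ.* ι (nV ∸ 1)) ∎

      -- Dropping `e` lowers the slack by one and the total by `ρ e`, so after raising `b` both
      -- sides fall by `ρ e`.
      skip : Covered H F es → Claim
      skip covered′ =
        let T , hypertree , bound = greedy F es (ρ e) sorted ρe≤es forest covered′ in
        T , hypertree , (begin
          b ℚ.* slack F (e ∷ es)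
            ≤⟨ raise ⟩
          ρ e ℚ.* ((1ℚ ℚ.+ ι (length es) ℚ.+ s ℚ.* ι ∣ F ∣) ℚ.- s ℚ.* ι (nV ∸ 1))
            ≡⟨ pull (ρ e) (ι (length es)) (s ℚ.* ι ∣ F ∣) (s ℚ.* ι (nV ∸ 1)) ⟩
          ρ e ℚ.+ ρ e ℚ.* slack F es
            ≤⟨ ℚ.+-monoʳ-≤ (ρ e) bound ⟩
          ρ e ℚ.+ ((total ρ es ℚ.+ s ℚ.* weight F ρ) ℚ.- s ℚ.* weight T ρ)
            ≡⟨ push (ρ e) (total ρ es) (s ℚ.* weight F ρ) (s ℚ.* weight T ρ) ⟩
          (total ρ (e ∷ es) ℚ.+ s ℚ.* weight F ρ) ℚ.- s ℚ.* weight T ρ ∎)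
        where
        open ℚ.+-*-Solver
        pull : ∀ r l x y → r ℚ.* ((1ℚ ℚ.+ l ℚ.+ x) ℚ.- y) ≡ r ℚ.+ r ℚ.* ((l ℚ.+ x) ℚ.- y)
        pull = solve 4 (λ r l x y → r :* ((con 1ℚ :+ l :+ x) :- y) := r :+ r :* ((l :+ x) :- y)) refl
        push : ∀ r t x y → r ℚ.+ ((t ℚ.+ x) ℚ.- y) ≡ ((r ℚ.+ t) ℚ.+ x) ℚ.- y
        push = solve 4 (λ r t x y → r :+ ((t :+ x) :- y) := ((r :+ t) :+ x) :- y) refl

      -- Accepting `e` also adds `s` to the slack and `s ℚ.* ρ e` to the weighted forest term, so
      -- both sides change by the same amount.
      take : e ∉ F → IsHyperforest H (F ∪ ⁅ e ⁆) → Covered H (F ∪ ⁅ e ⁆) es → Claim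
      take e∉F forest′ covered′ =
        let T , hypertree , bound = greedy (F ∪ ⁅ e ⁆) es (ρ e) sorted ρe≤es forest′ covered′ in
        T , hypertree , (begin
          b ℚ.* slack F (e ∷ es)
            ≤⟨ raise ⟩
          ρ e ℚ.* ((1ℚ ℚ.+ ι (length es) ℚ.+ s ℚ.* ι ∣ F ∣) ℚ.- s ℚ.* ι (nV ∸ 1))
            ≡⟨ pull (ρ e) (ι (length es)) s (ι ∣ F ∣) (s ℚ.* ι (nV ∸ 1)) ⟩
          (ρ e ℚ.- s ℚ.* ρ e) ℚ.+ ρ e ℚ.* ((ι (length es) ℚ.+ s ℚ.* (1ℚ ℚ.+ ι ∣ F ∣)) ℚ.- s ℚ.* ι (nV ∸ 1))
            ≡⟨ cong (λ m → (ρ e ℚ.- s ℚ.* ρ e) ℚ.+ ρ e ℚ.* ((ι (length es) ℚ.+ s ℚ.* m) ℚ.- s ℚ.* ι (nV ∸ 1)))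
                 (trans (sym (ι-+ 1 ∣ F ∣)) (cong ι (sym (∣F∪⁅e⁆∣ F e e∉F)))) ⟩
          (ρ e ℚ.- s ℚ.* ρ e) ℚ.+ ρ e ℚ.* slack (F ∪ ⁅ e ⁆) es
            ≤⟨ ℚ.+-monoʳ-≤ (ρ e ℚ.- s ℚ.* ρ e) bound ⟩
          (ρ e ℚ.- s ℚ.* ρ e) ℚ.+ ((total ρ es ℚ.+ s ℚ.* weight (F ∪ ⁅ e ⁆) ρ) ℚ.- s ℚ.* weight T ρ)
            ≡⟨ cong (λ w → (ρ e ℚ.- s ℚ.* ρ e) ℚ.+ ((total ρ es ℚ.+ s ℚ.* w) ℚ.- s ℚ.* weight T ρ))
                 (weight-∪⁅⁆ F e ρ e∉F) ⟩
          (ρ e ℚ.- s ℚ.* ρ e) ℚ.+ ((total ρ es ℚ.+ s ℚ.* (weight F ρ ℚ.+ ρ e)) ℚ.- s ℚ.* weight T ρ)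
            ≡⟨ push (ρ e) s (total ρ es) (weight F ρ) (s ℚ.* weight T ρ) ⟩
          (total ρ (e ∷ es) ℚ.+ s ℚ.* weight F ρ) ℚ.- s ℚ.* weight T ρ ∎)
        where
        open ℚ.+-*-Solver
        pull : ∀ r l s x y →
               r ℚ.* ((1ℚ ℚ.+ l ℚ.+ s ℚ.* x) ℚ.- y) ≡
               (r ℚ.- s ℚ.* r) ℚ.+ r ℚ.* ((l ℚ.+ s ℚ.* (1ℚ ℚ.+ x)) ℚ.- y)
        pull = solve 5 (λ r l s x y → r :* ((con 1ℚ :+ l :+ s :* x) :- y) :=
          (r :- s :* r) :+ r :* ((l :+ s :* (con 1ℚ :+ x)) :- y)) refl
        push : ∀ r s t x y → (r ℚ.- s ℚ.* r) ℚ.+ ((t ℚ.+ s ℚ.* (x ℚ.+ r)) ℚ.- y) ≡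
               ((r ℚ.+ t) ℚ.+ s ℚ.* x) ℚ.- y
        push = solve 5 (λ r s t x y →
          (r :- s :* r) :+ ((t :+ s :* (x :+ r)) :- y) := ((r :+ t) :+ s :* x) :- y) refl

      recover : ∀ {G} → F ⊆ G → e ∈ G ⊎ Spanned H G e → Covered H G es
      recover {G} F⊆G e-covered f with covered f
      ... | inj₁ f∈F = inj₁ (F⊆G f∈F)
      ... | inj₂ (inj₁ spanned) = inj₂ (inj₁ (Spanned-mono H F G F⊆G spanned))
      ... | inj₂ (inj₂ (here refl)) = Sum.map₂ inj₁ e-covered
      ... | inj₂ (inj₂ (there f∈es)) = inj₂ (inj₂ f∈es)

      -- Distinctness of the list is not part of the invariant, so membership in `F` is tested
      -- first; size and weight grow by exactly one hyperedge only when `e` is new.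
      branch : _ → _ → Claim
      branch (yes e∈F) _ = skip (recover {F} (λ e∈ → e∈) (inj₁ e∈F))
      branch (no _) (yes spanned) = skip (recover {F} (λ e∈ → e∈) (inj₂ spanned))
      branch (no e∉F) (no ¬spanned) = take e∉F (forest-extend H F e forest ¬spanned)
        (recover {F ∪ ⁅ e ⁆} (p⊆p∪q ⁅ e ⁆) (inj₁ (q⊆p∪q F ⁅ e ⁆ (x∈⁅x⁆ e))))

    -- The greedy bound is started from the empty forest with `b = 0ℚ`, valid because `ρ` is
    -- nonnegative; its left side is then zero.
    light-hypertree : (∀ e → 0ℚ ℚ.≤ ρ e) →
                      ∃[ T ] (IsHypertree H T × s ℚ.* weight T ρ ℚ.≤ weight ⊤ ρ)
    light-hypertree 0≤ρ =
      let T , hypertree , bound = greedy ⊥ es 0ℚ (Sorted⇒AllPairs totalOrder (sort-↗ (allFin nE)))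
            (All.universal 0≤ρ es) (⊥-forest H)
            λ e → inj₂ (inj₂ (∈-resp-↭ (↭-sym (sort-↭ (allFin nE))) (∈-tabulate⁺ e)))
      in T , hypertree , 0≤q-p⇒p≤q (begin
        0ℚ  ≡⟨ ℚ.*-zeroˡ (slack ⊥ es) ⟨
        0ℚ ℚ.* slack ⊥ es  ≤⟨ bound ⟩
        (total ρ es ℚ.+ s ℚ.* weight ⊥ ρ) ℚ.- s ℚ.* weight T ρ
          ≡⟨ cong₂ (λ t w → (t ℚ.+ s ℚ.* w) ℚ.- s ℚ.* weight T ρ)
               (trans (total-↭ ρ (sort-↭ (allFin nE))) (total-allFin ρ)) (weight-⊥ ρ) ⟩
        (weight ⊤ ρ ℚ.+ s ℚ.* 0ℚ) ℚ.- s ℚ.* weight T ρ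
          ≡⟨ cong (ℚ._- s ℚ.* weight T ρ)
               (trans (cong (weight ⊤ ρ ℚ.+_) (ℚ.*-zeroʳ s)) (ℚ.+-identityʳ (weight ⊤ ρ))) ⟩
        weight ⊤ ρ ℚ.- s ℚ.* weight T ρ ∎)
      where
      open ℚ.≤-Reasoning
      order = On.decTotalOrder ℚ.≤-decTotalOrder ρ
      open DecTotalOrder order using (totalOrder)
      open Sort order using (sort; sort-↭; sort-↗)
      es = sort (allFin nE)

-- The modulus over the reals

Eventually : (ℕ → Set) → Set
Eventually P = ∃[ N ] (∀ n → N ≤ n → P n)

eventually-map : ∀ {P Q : ℕ → Set} → (∀ n → P n → Q n) → Eventually P → Eventually Q
eventually-map P⇒Q (N , p) = N , λ n N≤n → P⇒Q n (p n N≤n)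

eventually-× : ∀ {P Q : ℕ → Set} → Eventually P → Eventually Q → Eventually (λ n → P n × Q n)
eventually-× (M , p) (N , q) = M ℕ.⊔ N , λ n ≤n →
  p n (ℕ.m⊔n≤o⇒m≤o M N ≤n) , q n (ℕ.m⊔n≤o⇒n≤o M N ≤n)

eventually-∀Fin : ∀ {m} {P : Fin m → ℕ → Set} →
                  (∀ i → Eventually (P i)) → Eventually (λ n → ∀ i → P i n)
eventually-∀Fin {ℕ.zero} ev = 0 , λ _ _ ()
eventually-∀Fin {ℕ.suc m} ev = eventually-map
  (λ { n (p₀ , p) zero → p₀ ; n (p₀ , p) (suc i) → p i })
  (eventually-× (ev zero) (eventually-∀Fin (ev ∘ suc)))

-- Splitting on the first bit merges the finitely many thresholds by maxima.
eventually-∀Subset : ∀ {m} {P : Subset m → ℕ → Set} →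
                     (∀ F → Eventually (P F)) → Eventually (λ n → ∀ F → P F n)
eventually-∀Subset {ℕ.zero} ev = eventually-map (λ { n p [] → p }) (ev [])
eventually-∀Subset {ℕ.suc m} ev = eventually-map
  (λ { n (p , q) (inside ∷ F) → p F ; n (p , q) (outside ∷ F) → q F })
  (eventually-× (eventually-∀Subset (ev ∘ (inside ∷_))) (eventually-∀Subset (ev ∘ (outside ∷_))))

p≤p+q : ∀ p {q} → 0ℚ ℚ.≤ q → p ℚ.≤ p ℚ.+ q
p≤p+q p {q} 0≤q = subst (ℚ._≤ p ℚ.+ q) (ℚ.+-identityʳ p) (ℚ.+-monoʳ-≤ p 0≤q)

pointwise⇒≤ᴿ : ∀ x y → (∀ n → seq x n ℚ.≤ seq y n) → x ≤ᴿ y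
pointwise⇒≤ᴿ x y x≤y ε 0<ε = 0 , λ n _ → ℚ.≤-trans (x≤y n) (p≤p+q (seq y n) (ℚ.<⇒≤ 0<ε))

module _ (H : Hypergraph) where
  open Hypergraph H

  seq-familyᵀ : ∀ T (ρ : Vector ℝ nE) n →
    seq (hypertreeFamily H T ᵀ ρ) n ≡ weight (proj₁ T) (λ e → seq (ρ e) n)
  seq-familyᵀ (T , hypertree) ρ n = trans (seq-ᵀ (hypertreeFamily H (T , hypertree)) ρ n)
    (indicator-* T (λ e → seq (ρ e) n) n)

  isHypertree? : ∀ F → Dec (IsHypertree H F)
  isHypertree? F = isHyperforest? ×-dec (∣ F ∣ ℕ.≟ nV ∸ 1)
    where
    bounded? : ∀ X → Dec (∣ F ∩ edgesWithin H X ∣ ≤ ∣ X ∣ ∸ 1)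
    bounded? X = ∣ F ∩ edgesWithin H X ∣ ℕ.≤? ∣ X ∣ ∸ 1
    isHyperforest? : Dec (IsHyperforest H F)
    isHyperforest? = map′
      (λ none X ne → decidable-stable (bounded? X) λ unbounded → none (X , ne , unbounded))
      (λ forest (X , ne , unbounded) → unbounded (forest X ne))
      (¬? (anySubset? λ X → nonempty? X ×-dec ¬? (bounded? X)))

  ratio*ι : ∀ P 2≤k → ratio H P 2≤k ℚ.* ι (size P ∸ 1) ≡ ι ∣ δ H P ∣
  ratio*ι P 2≤k = n/k*ιk≡ιn ∣ δ H P ∣ (size P ∸ 1) {{ℕ.>-nonZero (ℕ.m<n⇒0<n∸m 2≤k)}}

  -- Clears the denominator and extends the bound to the one-part partition, which can arise as the
  -- tight partition; there the left side is zero.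
  strength-bound : ∀ {s} → IsStrength H s → ∀ P → s ℚ.* ι (size P ∸ 1) ℚ.≤ ι ∣ δ H P ∣
  strength-bound {s} (_ , min) P = bound (2 ℕ.≤? size P)
    where
    open ℚ.≤-Reasoning
    bound : Dec (2 ≤ size P) → s ℚ.* ι (size P ∸ 1) ℚ.≤ ι ∣ δ H P ∣
    bound (yes 2≤k) = begin
      s ℚ.* ι (size P ∸ 1)  ≤⟨ ℚ.*-monoʳ-≤-nonNeg (ι (size P ∸ 1)) {{ι-nonNeg (size P ∸ 1)}}
                               (min (ratio H P 2≤k) (P , 2≤k , refl)) ⟩
      ratio H P 2≤k ℚ.* ι (size P ∸ 1)  ≡⟨ ratio*ι P 2≤k ⟩
      ι ∣ δ H P ∣  ∎
    bound (no 2≰k) = begin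
      s ℚ.* ι (size P ∸ 1)  ≡⟨ cong (λ m → s ℚ.* ι m) (ℕ.m≤n⇒m∸n≡0 (ℕ.≤-pred (ℕ.≰⇒> 2≰k))) ⟩
      s ℚ.* 0ℚ              ≡⟨ ℚ.*-zeroʳ s ⟩
      0ℚ                  ≤⟨ ι-mono (ℕ.z≤n {∣ δ H P ∣}) ⟩
      ι ∣ δ H P ∣  ∎

  1≤ratio : PartitionConnected H → ∀ P 2≤k → 1ℚ ℚ.≤ ratio H P 2≤k
  1≤ratio connected P 2≤k = ℚ.*-cancelʳ-≤-pos (ι k) {{ι-pos k {{ℕ.>-nonZero (ℕ.m<n⇒0<n∸m 2≤k)}}}} (begin
    1ℚ ℚ.* ι k  ≡⟨ ℚ.*-identityˡ (ι k) ⟩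
    ι k  ≤⟨ ι-mono (connected P) ⟩
    ι ∣ δ H P ∣  ≡⟨ ratio*ι P 2≤k ⟨
    ratio H P 2≤k ℚ.* ι k ∎)
    where
    open ℚ.≤-Reasoning
    k = size P ∸ 1

  -- Being a hypertree is a premise inside `Eventually`, so that one threshold can later be chosen
  -- for all subsets. Deciding it selects the threshold: zero when `T` is not a hypertree.
  admissible⇒heavy : ∀ {ρ η} → Adm (hypertreeFamily H) ρ → 0ℚ ℚ.< η → ∀ T →
    Eventually (λ n → IsHypertree H T → 1ℚ ℚ.≤ weight T (λ e → seq (ρ e) n) ℚ.+ η)
  admissible⇒heavy {ρ} {η} (_ , ρ≥1) 0<η T = case-on (isHypertree? T)
    where
    case-on : Dec (IsHypertree H T) →
              Eventually (λ n → IsHypertree H T → 1ℚ ℚ.≤ weight T (λ e → seq (ρ e) n) ℚ.+ η)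
    case-on (no ¬hypertree) = 0 , λ _ _ hypertree → contradiction hypertree ¬hypertree
    case-on (yes hypertree) = let N , N≤⇒ = ρ≥1 (T , hypertree) η 0<η in
      N , λ n N≤n _ → subst (λ w → 1ℚ ℚ.≤ w ℚ.+ η) (seq-familyᵀ (T , hypertree) ρ n) (N≤⇒ n N≤n)

  module _ (2≤n : 2 ≤ nV) (connected : PartitionConnected H) {s : ℚ} (1≤s : 1ℚ ℚ.≤ s)
           (s-bound : ∀ P → s ℚ.* ι (size P ∸ 1) ℚ.≤ ι ∣ δ H P ∣) where
    open ℚ.≤-Reasoning

    -- At a fixed index the rational densities are admissible only up to `η`. Adding `η` to every
    -- density repairs nonnegativity and also the hypertree constraints, because a hypertree has at
    -- least one hyperedge; the total grows by `ι nE ℚ.* η`.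
    almost-admissible-bound : ∀ (ρ : Fin nE → ℚ) η → 0ℚ ℚ.≤ η → (∀ e → 0ℚ ℚ.≤ ρ e ℚ.+ η) →
      (∀ T → IsHypertree H T → 1ℚ ℚ.≤ weight T ρ ℚ.+ η) → s ℚ.≤ weight ⊤ ρ ℚ.+ (1ℚ ℚ.+ ι nE) ℚ.* η
    almost-admissible-bound ρ η 0≤η ρ+η≥0 T≥1 =
      let T , hypertree , s*w≤ = light-hypertree H s 1≤s s-bound connected (λ e → ρ e ℚ.+ η) ρ+η≥0 in
      begin
        s                                    ≡⟨ ℚ.*-identityʳ s ⟨
        s ℚ.* 1ℚ                               ≤⟨ ℚ.*-monoˡ-≤-nonNeg s {{s-nonNeg H s 1≤s s-bound}}
                                                  (T+η≥1 T hypertree) ⟩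
        s ℚ.* weight T (λ e → ρ e ℚ.+ η)         ≤⟨ s*w≤ ⟩
        weight ⊤ (λ e → ρ e ℚ.+ η)             ≡⟨ weight-+const ⊤ ρ η ⟩
        weight ⊤ ρ ℚ.+ ι ∣ ⊤ {nE} ∣ ℚ.* η        ≡⟨ cong (λ m → weight ⊤ ρ ℚ.+ ι m ℚ.* η) (∣⊤∣≡n nE) ⟩
        weight ⊤ ρ ℚ.+ ι nE ℚ.* η                ≤⟨ ℚ.+-monoʳ-≤ (weight ⊤ ρ) ιnE*η≤ ⟩
        weight ⊤ ρ ℚ.+ (1ℚ ℚ.+ ι nE) ℚ.* η         ∎
      where
      ιnE*η≤ : ι nE ℚ.* η ℚ.≤ (1ℚ ℚ.+ ι nE) ℚ.* η
      ιnE*η≤ = ℚ.*-monoʳ-≤-nonNeg η {{ℚ.nonNegative 0≤η}}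
        (subst (ℚ._≤ 1ℚ ℚ.+ ι nE) (ℚ.+-identityˡ (ι nE)) (ℚ.+-monoˡ-≤ (ι nE) (ℚ.nonNegative⁻¹ 1ℚ)))
      T+η≥1 : ∀ T → IsHypertree H T → 1ℚ ℚ.≤ weight T (λ e → ρ e ℚ.+ η)
      T+η≥1 T (forest , ∣T∣≡) = begin
        1ℚ                             ≤⟨ T≥1 T (forest , ∣T∣≡) ⟩
        weight T ρ ℚ.+ η                 ≡⟨ cong (weight T ρ ℚ.+_) (ℚ.*-identityˡ η) ⟨
        weight T ρ ℚ.+ ι 1 ℚ.* η
          ≤⟨ ℚ.+-monoʳ-≤ (weight T ρ)
               (ℚ.*-monoʳ-≤-nonNeg η {{ℚ.nonNegative 0≤η}} (ι-mono 1≤∣T∣)) ⟩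
        weight T ρ ℚ.+ ι ∣ T ∣ ℚ.* η       ≡⟨ weight-+const T ρ η ⟨
        weight T (λ e → ρ e ℚ.+ η)       ∎
        where
        1≤∣T∣ : 1 ≤ ∣ T ∣
        1≤∣T∣ = subst (1 ≤_) (sym ∣T∣≡) (ℕ.∸-monoˡ-≤ 1 2≤n)

    strength≤Mod₁ : ∀ ρ → Adm (hypertreeFamily H) ρ → fromℚ s ≤ᴿ sum ρ
    strength≤Mod₁ ρ (ρ≥0 , ρ≥1) ε 0<ε =
      -- The error is chosen to make the final loss exactly `ε`; the summand `1ℚ` keeps the divisor
      -- positive even when there are no hyperedges.
      let η , 0<η , eq = divide (1ℚ ℚ.+ ι nE) ε
            (ℚ.+-mono-<-≤ (ℚ.positive⁻¹ 1ℚ) (ι-mono (ℕ.z≤n {nE}))) 0<ε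
          N , N≤⇒ = eventually-×
            (eventually-∀Fin {P = λ e n → 0ℚ ℚ.≤ seq (ρ e) n ℚ.+ η} λ e → ρ≥0 e η 0<η)
            (eventually-∀Subset
              {P = λ T n → IsHypertree H T → 1ℚ ℚ.≤ weight T (λ e → seq (ρ e) n) ℚ.+ η}
              (admissible⇒heavy {ρ} {η} (ρ≥0 , ρ≥1) 0<η))
      in N , λ n N≤n → let ρ+η≥0 , T≥1 = N≤⇒ n N≤n in
        subst₂ (λ w r → s ℚ.≤ w ℚ.+ r) (sym (seq-sum ρ n)) eq
          (almost-admissible-bound (λ e → seq (ρ e) n) η (ℚ.<⇒≤ 0<η) ρ+η≥0 T≥1)

  -- The density with value `c` on `D` and zero elsewhere is admissible by assumption, so any lower
  -- bound `l` can be tested against it.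
  Mod₁≤ι∣D∣*c : ∀ D c → 0ℚ ℚ.≤ c → (∀ T → IsHypertree H T → 1ℚ ℚ.≤ ι ∣ T ∩ D ∣ ℚ.* c) →
    ∀ l → (∀ ρ → Adm (hypertreeFamily H) ρ → l ≤ᴿ sum ρ) → l ≤ᴿ fromℚ (ι ∣ D ∣ ℚ.* c)
  Mod₁≤ι∣D∣*c D c 0≤c T≥1 l lower ε 0<ε =
    let N , N≤⇒ = lower ρ (ρ≥0 , ρ≥1) ε 0<ε in
    N , λ n N≤n → subst (λ q → seq l n ℚ.≤ q ℚ.+ ε) (total≡ n) (N≤⇒ n N≤n)
    where
    κ : Fin nE → ℚ
    κ e = if does (e ∈? D) then c else 0ℚ
    ρ : Vector ℝ nE
    ρ e = fromℚ (κ e)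

    if-nonNeg : ∀ b → 0ℚ ℚ.≤ (if b then c else 0ℚ)
    if-nonNeg true = 0≤c
    if-nonNeg false = ℚ.≤-refl

    ρ≥0 : ∀ e → 0ℝ ≤ᴿ ρ e
    ρ≥0 e = pointwise⇒≤ᴿ 0ℝ (ρ e) λ _ → if-nonNeg (does (e ∈? D))

    ρ≥1 : ∀ T → 1ℝ ≤ᴿ hypertreeFamily H T ᵀ ρ
    ρ≥1 (T , hypertree) = pointwise⇒≤ᴿ 1ℝ (hypertreeFamily H (T , hypertree) ᵀ ρ) λ n →
      subst (1ℚ ℚ.≤_) (trans (sym (weight-indicator T D c)) (sym (seq-familyᵀ (T , hypertree) ρ n)))
        (T≥1 T hypertree)

    total≡ : ∀ n → seq (sum ρ) n ≡ ι ∣ D ∣ ℚ.* c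
    total≡ n = trans (seq-sum ρ n) (trans (weight-indicator ⊤ D c)
      (cong (λ F → ι ∣ F ∣ ℚ.* c) (∩-identityˡ D)))

  Mod₁≤ratio : ∀ P 2≤k l → (∀ ρ → Adm (hypertreeFamily H) ρ → l ≤ᴿ sum ρ) →
               l ≤ᴿ fromℚ (ratio H P 2≤k)
  Mod₁≤ratio P 2≤k l lower =
    let k = size P ∸ 1
        -- The constant is the reciprocal of |P| - 1; every hypertree crosses `P` at least |P| - 1
        -- times, so its total density is at least one.
        c , 0<c , ιk*c≡1 = divide (ι k) 1ℚ
          (ℚ.positive⁻¹ (ι k) {{ι-pos k {{ℕ.>-nonZero (ℕ.m<n⇒0<n∸m 2≤k)}}}}) (ℚ.positive⁻¹ 1ℚ)
        0≤c = ℚ.<⇒≤ 0<c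
        ι∣δ∣*c≡ratio = begin
          ι ∣ δ H P ∣ ℚ.* c                ≡⟨ cong (ℚ._* c) (ratio*ι P 2≤k) ⟨
          (ratio H P 2≤k ℚ.* ι k) ℚ.* c      ≡⟨ ℚ.*-assoc (ratio H P 2≤k) (ι k) c ⟩
          ratio H P 2≤k ℚ.* (ι k ℚ.* c)      ≡⟨ cong (ratio H P 2≤k ℚ.*_) ιk*c≡1 ⟩
          ratio H P 2≤k ℚ.* 1ℚ             ≡⟨ ℚ.*-identityʳ (ratio H P 2≤k) ⟩
          ratio H P 2≤k                  ∎
    in subst (λ q → l ≤ᴿ fromℚ q) ι∣δ∣*c≡ratio
         (Mod₁≤ι∣D∣*c (δ H P) c 0≤c
           (λ T hypertree → subst (ℚ._≤ ι ∣ T ∩ δ H P ∣ ℚ.* c) ιk*c≡1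
             (ℚ.*-monoʳ-≤-nonNeg c {{ℚ.nonNegative 0≤c}}
               (ι-mono (hypertree-crossings H T hypertree P))))
           l lower)
    where open ≡-Reasoning

theorem1p7 : (H : Hypergraph) →
    2 ≤ Hypergraph.nV H →
    PartitionConnected H →
    ∃[ s ] (IsStrength H s × IsMod₁ (hypertreeFamily H) (fromℚ s))
theorem1p7 H 2≤n connected =
  let s , (P , 2≤k , s≡) , min = ∃strength H 2≤n
      strength = (P , 2≤k , s≡) , min
      -- The minimizing partition serves twice: partition-connectedness bounds its ratio below by
      -- one, and its cut carries the optimal density.
      1≤s = subst (1ℚ ℚ.≤_) (sym s≡) (1≤ratio H connected P 2≤k)
  in s , strength
   , strength≤Mod₁ H 2≤n connected 1≤s (strength-bound H strength)
   , λ l lower → subst (λ q → l ≤ᴿ fromℚ q) (sym s≡) (Mod₁≤ratio H P 2≤k l lower)
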